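{- Let $D$ be a two-input two-output signal flow graph whose first-order branches' open-loop poles $z_1,\dots,z_n$ are either indeterminates or constants, let $\Sigma(A,B,C)$ be its linear system, and let $T=C(sI-A)^{ -1}B$ be its $2\times2$ transfer function matrix ($T(s,z)$ or $T(s)$). If $T$ is invertible, then there exists at least one general 2-path in $D$.
   Context: A standard signal flow graph (SFG) is a finite directed graph without parallel branches and without self-loops, whose branches are of two types: first-order branches $x_1,\dots,x_n$, the branch $x_i$ having gain $1/(s-z_i)$ ($z_i$ is called its open-loop pole) and being followed in series by a zero-order branch of gain $1$; and zero-order branches of gain $1$. Every node variable is the sum of the signals carried by the branches entering it; if $w$ is the variable of the input node of the first-order branch $x_i$, then its output (state variable) $x_i$ satisfies $\dot x_i=z_ix_i+w$. In the two-input two-output (TITO) case there are distinct input nodes $u_1,u_2$ of in-degree $0$ and distinct output nodes $y_1,y_2$ of out-degree $0$. Every node other than input and output nodes has in-degree at most $1$ or out-degree at most $1$. The corresponding linear system $\Sigma(A,B,C)$ is $\dot x=Ax+Bu$, $y=Cx$ with $x=[x_1,\dots,x_n]^T$, $u=[u_1,u_2]^T$, $y=[y_1,y_2]^T$, where $A$ has diagonal entries $z_1,\dots,z_n$, every off-diagonal entry of $A$ is $0$ or $1$, and all entries of $B$ and $C$ are $0$ or $1$. Invertibility is over the field of rational functions in $s$ with coefficients in $F(z)$ (the field of real rational functions in the indeterminates $z$) or in $\mathbb{R}$ (when the poles are real constants). A path is a directed walk passing through each of its nodes only once. A general 2-path is a pair of node-disjoint paths $P_1,P_2$ such that $P_i$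 goes from $u_{j_i}$ to $y_i$ ($i=1,2$), where $(j_1,j_2)$ is some permutation of $(1,2)$. -}

module Defs where

open import Algebra.Apartness using (HeytingCommutativeRing; HeytingField)
open import Algebra.Bundles using (CommutativeRing)
import Algebra.Apartness.Properties.HeytingCommutativeRing as HeytingProperties
import Algebra.Definitions as AlgebraDefinitions
import Algebra.Properties.Monoid.Sum as MonoidSum
import Algebra.Properties.Ring as RingProperties
import Algebra.Solver.Ring.NaturalCoefficients.Default as SemiringSolver
open import Data.Bool.Base using (if_then_else_)
open import Data.Empty using (⊥-elim)
open import Data.Fin.Base using (Fin; zero; suc)
open import Data.Fin.Patterns using (0F; 1F)
open import Data.Fin.Permutation using (Permutation′; _⟨$⟩ʳ_)
open import Data.Fin.Properties using (_≟_)
open import Data.List.Base using (List; []; _∷_; _++_; allFin; filter; foldr; length; map)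
open import Data.List.Relation.Binary.Disjoint.Propositional using (Disjoint)
open import Data.List.Relation.Unary.Unique.Propositional using (Unique)
open import Data.Nat.Base using (ℕ; zero; suc; _≤_)
open import Data.Product.Base using (Σ; ∃; ∃-syntax; _×_; _,_; proj₁; proj₂)
open import Data.Sum.Base as Sum using (_⊎_; inj₁; inj₂)
open import Data.Vec.Functional using (Vector)
open import Function.Base using (_∘_)
open import Function.Definitions using (Injective)
open import Level using (Level; _⊔_)
import Relation.Binary.Reasoning.Setoid as SetoidReasoning
open import Relation.Binary.Construct.Closure.ReflexiveTransitive using (Star; ε; _◅_)
open import Relation.Binary.PropositionalEquality.Core as ≡ using (_≡_; _≢_)
open import Relation.Nullary.Decidable.Core using (does)
open import Relation.Nullary.Negation.Core using (¬_)

private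
  variable
    c ℓ ℓ′ : Level

------------------------------------------------------------------------
-- Fields of rational functions

-- "Being apart from 0" on an integral domain, as a primitive predicate: over
-- a Heyting field (such as the reals) inequality with 0 is too weak to divide.
record IsApartDomain (R : CommutativeRing c ℓ)
                     (NonZero : CommutativeRing.Carrier R → Set ℓ′) : Set (c ⊔ ℓ ⊔ ℓ′) where
  open CommutativeRing R
  field
    nz-cong : ∀ {x y} → x ≈ y → NonZero x → NonZero y
    nz-1    : NonZero 1#
    nz-+    : ∀ {x y} → NonZero (x + y) → NonZero x ⊎ NonZero y
    nz-*    : ∀ {x y} → NonZero x → NonZero y → NonZero (x * y)
    nz-*⁻ˡ  : ∀ {x y} → NonZero (x * y) → NonZero x
    ¬nz-0   : ¬ NonZero 0#
    ¬nz⇒≈0  : ∀ {x} → ¬ NonZero x → x ≈ 0#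

module _ (R : CommutativeRing c ℓ)
         {NonZero : CommutativeRing.Carrier R → Set ℓ′}
         (dom : IsApartDomain R NonZero) where
  open CommutativeRing R
  open IsApartDomain dom
  open AlgebraDefinitions _≈_ using (Invertible)
  open RingProperties ring
  open SetoidReasoning setoid

  private
    nz-*⁻ʳ : ∀ {x y} → NonZero (x * y) → NonZero y
    nz-*⁻ʳ p = nz-*⁻ˡ (nz-cong (*-comm _ _) p)

    nz-neg : ∀ {x} → NonZero x → NonZero (- x)
    nz-neg {x} p = nz-*⁻ˡ {y = - 1#} (nz-cong eq p)
      where
      eq : x ≈ - x * - 1#
      eq = begin
        x              ≈⟨ -‿involutive x ⟨
        - - x          ≈⟨ -‿cong (*-identityʳ (- x)) ⟨
        - (- x * 1#)   ≈⟨ -‿distribʳ-* (- x) 1# ⟩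
        - x * - 1#     ∎

    cancel : ∀ d {x y} → NonZero d → d * x ≈ d * y → x ≈ y
    cancel d {x} {y} nzd eq = begin
      x                ≈⟨ +-identityʳ x ⟨
      x + 0#           ≈⟨ +-congˡ (-‿inverseˡ y) ⟨
      x + (- y + y)    ≈⟨ +-assoc _ _ _ ⟨
      (x - y) + y      ≈⟨ +-congʳ (¬nz⇒≈0 λ p → ¬nz-0 (nz-cong zero-prod (nz-* nzd p))) ⟩
      0# + y           ≈⟨ +-identityˡ y ⟩
      y                ∎
      where
      zero-prod : d * (x - y) ≈ 0#
      zero-prod = begin
        d * (x - y)        ≈⟨ distribˡ d x (- y) ⟩
        d * x + d * - y    ≈⟨ +-cong eq (sym (-‿distribʳ-* d y)) ⟩
        d * y - d * y      ≈⟨ -‿inverseʳ _ ⟩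
        0#                 ∎

    telescope : ∀ x y z → x - y ≈ (x - z) + (z - y)
    telescope x y z = begin
      x - y                  ≈⟨ +-congˡ (+-identityˡ _) ⟨
      x + (0# - y)           ≈⟨ +-congˡ (+-congʳ (-‿inverseˡ z)) ⟨
      x + ((- z + z) - y)    ≈⟨ +-congˡ (+-assoc _ _ _) ⟩
      x + (- z + (z - y))    ≈⟨ +-assoc _ _ _ ⟨
      (x - z) + (z - y)      ∎

    swap-neg : ∀ x y → - (x - y) ≈ y - x
    swap-neg x y = begin
      - (x - y)       ≈⟨ -‿+-comm x (- y) ⟨
      - x + - - y     ≈⟨ +-congˡ (-‿involutive y) ⟩
      - x + y         ≈⟨ +-comm _ _ ⟩
      y - x           ∎

  heytingField : (∀ {x} → NonZero x → Invertible 1# _*_ x) → HeytingField c ℓ ℓ′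
  heytingField inv = record
    { Carrier = Carrier
    ; _≈_ = _≈_
    ; _#_ = λ x y → NonZero (x - y)
    ; _+_ = _+_
    ; _*_ = _*_
    ; -_ = -_
    ; 0# = 0#
    ; 1# = 1#
    ; isHeytingField = record
      { isHeytingCommutativeRing = record
        { isCommutativeRing = isCommutativeRing
        ; isApartnessRelation = record
          { irrefl = irr
          ; sym = λ {x} {y} p → nz-cong (swap-neg x y) (nz-neg p)
          ; cotrans = λ {x} {y} p z → nz-+ (nz-cong (telescope x y z) p)
          }
        ; #⇒invertible = inv
        ; invertible⇒# = λ (_ , _ , eq) → nz-*⁻ˡ (nz-cong (sym eq) nz-1)
        }
      ; tight = λ x y → tight⇒ , irr
      }
    }
    where
    irr : ∀ {x y} → x ≈ y → ¬ NonZero (x - y)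
    irr {x} {y} eq p = ¬nz-0 (nz-cong (trans (+-congʳ eq) (-‿inverseʳ y)) p)

    tight⇒ : ∀ {x y} → ¬ NonZero (x - y) → x ≈ y
    tight⇒ {x} {y} ¬p = cancel 1# nz-1 (begin
      1# * x              ≈⟨ *-identityˡ x ⟩
      x                   ≈⟨ +-identityʳ x ⟨
      x + 0#              ≈⟨ +-congˡ (-‿inverseˡ y) ⟨
      x + (- y + y)       ≈⟨ +-assoc _ _ _ ⟨
      (x - y) + y         ≈⟨ +-congʳ (¬nz⇒≈0 ¬p) ⟩
      0# + y              ≈⟨ +-identityˡ y ⟩
      y                   ≈⟨ *-identityˡ y ⟨
      1# * y              ∎)

  record Fraction : Set (c ⊔ ℓ′) where
    constructor fraction
    field
      num    : Carrier
      den    : Carrier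
      den-nz : NonZero den

  open Fraction

  private
    open SemiringSolver commutativeSemiring

    infix 4 _≈ᶠ_

    _≈ᶠ_ : Fraction → Fraction → Set ℓ
    p ≈ᶠ q = num p * den q ≈ num q * den p

    _+ᶠ_ _*ᶠ_ : Fraction → Fraction → Fraction
    p +ᶠ q = fraction (num p * den q + num q * den p) (den p * den q) (nz-* (den-nz p) (den-nz q))
    p *ᶠ q = fraction (num p * num q) (den p * den q) (nz-* (den-nz p) (den-nz q))

    -ᶠ_ : Fraction → Fraction
    -ᶠ p = fraction (- num p) (den p) (den-nz p)

    0ᶠ 1ᶠ : Fraction
    0ᶠ = fraction 0# 1# nz-1
    1ᶠ = fraction 1# 1# nz-1

    ≈ᶠ-trans : ∀ {p q r} → p ≈ᶠ q → q ≈ᶠ r → p ≈ᶠ r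
    ≈ᶠ-trans {fraction a b _} {fraction c d d≠0} {fraction e f _} ad≈cb cf≈ed =
      cancel d d≠0 (begin
        d * (a * f)    ≈⟨ solve 3 (λ a d f → d :* (a :* f) := (a :* d) :* f) refl a d f ⟩
        (a * d) * f    ≈⟨ *-congʳ ad≈cb ⟩
        (c * b) * f    ≈⟨ solve 3 (λ b c f → (c :* b) :* f := (c :* f) :* b) refl b c f ⟩
        (c * f) * b    ≈⟨ *-congʳ cf≈ed ⟩
        (e * d) * b    ≈⟨ solve 3 (λ b d e → (e :* d) :* b := d :* (e :* b)) refl b d e ⟩
        d * (e * b)    ∎)

    +ᶠ-cong : ∀ {p p′ q q′} → p ≈ᶠ p′ → q ≈ᶠ q′ → (p +ᶠ q) ≈ᶠ (p′ +ᶠ q′)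
    +ᶠ-cong {fraction a b _} {fraction a′ b′ _} {fraction c d _} {fraction c′ d′ _} e₁ e₂ = begin
      (a * d + c * b) * (b′ * d′)
        ≈⟨ solve 6 (λ a b b′ c d d′ → (a :* d :+ c :* b) :* (b′ :* d′)
                    := (a :* b′) :* (d :* d′) :+ (c :* d′) :* (b :* b′)) refl a b b′ c d d′ ⟩
      (a * b′) * (d * d′) + (c * d′) * (b * b′)
        ≈⟨ +-cong (*-congʳ e₁) (*-congʳ e₂) ⟩
      (a′ * b) * (d * d′) + (c′ * d) * (b * b′)
        ≈⟨ solve 6 (λ a′ b b′ c′ d d′ → (a′ :* b) :* (d :* d′) :+ (c′ :* d) :* (b :* b′)
                    := (a′ :* d′ :+ c′ :* b′) :* (b :* d)) refl a′ b b′ c′ d d′ ⟩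
      (a′ * d′ + c′ * b′) * (b * d) ∎

    *ᶠ-cong : ∀ {p p′ q q′} → p ≈ᶠ p′ → q ≈ᶠ q′ → (p *ᶠ q) ≈ᶠ (p′ *ᶠ q′)
    *ᶠ-cong {fraction a b _} {fraction a′ b′ _} {fraction c d _} {fraction c′ d′ _} e₁ e₂ = begin
      (a * c) * (b′ * d′)
        ≈⟨ solve 4 (λ a b′ c d′ → (a :* c) :* (b′ :* d′) := (a :* b′) :* (c :* d′)) refl a b′ c d′ ⟩
      (a * b′) * (c * d′)
        ≈⟨ *-cong e₁ e₂ ⟩
      (a′ * b) * (c′ * d)
        ≈⟨ solve 4 (λ a′ b c′ d → (a′ :* b) :* (c′ :* d) := (a′ :* c′) :* (b :* d)) refl a′ b c′ d ⟩
      (a′ * c′) * (b * d) ∎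

    -ᶠ-cong : ∀ {p q} → p ≈ᶠ q → (-ᶠ p) ≈ᶠ (-ᶠ q)
    -ᶠ-cong {fraction a b _} {fraction c d _} e = begin
      - a * d      ≈⟨ -‿distribˡ-* a d ⟨
      - (a * d)    ≈⟨ -‿cong e ⟩
      - (c * b)    ≈⟨ -‿distribˡ-* c b ⟩
      - c * b      ∎

    -ᶠ-inverseˡ : ∀ p → ((-ᶠ p) +ᶠ p) ≈ᶠ 0ᶠ
    -ᶠ-inverseˡ (fraction a b _) = begin
      (- a * b + a * b) * 1#    ≈⟨ *-identityʳ _ ⟩
      - a * b + a * b           ≈⟨ distribʳ b (- a) a ⟨
      (- a + a) * b             ≈⟨ *-congʳ (-‿inverseˡ a) ⟩
      0# * b                    ≈⟨ zeroˡ b ⟩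
      0#                        ≈⟨ zeroˡ _ ⟨
      0# * (b * b)              ∎

    +ᶠ-comm : ∀ p q → (p +ᶠ q) ≈ᶠ (q +ᶠ p)
    +ᶠ-comm (fraction a b _) (fraction c d _) =
      solve 4 (λ a b c d → (a :* d :+ c :* b) :* (d :* b) := (c :* b :+ a :* d) :* (b :* d)) refl a b c d

    *ᶠ-comm : ∀ p q → (p *ᶠ q) ≈ᶠ (q *ᶠ p)
    *ᶠ-comm (fraction a b _) (fraction c d _) =
      solve 4 (λ a b c d → (a :* c) :* (d :* b) := (c :* a) :* (b :* d)) refl a b c d

    +ᶠ-identityˡ : ∀ p → (0ᶠ +ᶠ p) ≈ᶠ p
    +ᶠ-identityˡ (fraction a b _) =
      solve 2 (λ a b → (con 0 :* b :+ a :* con 1) :* b := a :* (con 1 :* b)) refl a b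

    *ᶠ-identityˡ : ∀ p → (1ᶠ *ᶠ p) ≈ᶠ p
    *ᶠ-identityˡ (fraction a b _) =
      solve 2 (λ a b → (con 1 :* a) :* b := a :* (con 1 :* b)) refl a b

    +ᶠ-assoc : ∀ p q r → ((p +ᶠ q) +ᶠ r) ≈ᶠ (p +ᶠ (q +ᶠ r))
    +ᶠ-assoc (fraction a b _) (fraction c d _) (fraction e f _) =
      solve 6 (λ a b c d e f →
        ((a :* d :+ c :* b) :* f :+ e :* (b :* d)) :* (b :* (d :* f))
        := (a :* (d :* f) :+ (c :* f :+ e :* d) :* b) :* ((b :* d) :* f)) refl a b c d e f

    *ᶠ-assoc : ∀ p q r → ((p *ᶠ q) *ᶠ r) ≈ᶠ (p *ᶠ (q *ᶠ r))
    *ᶠ-assoc (fraction a b _) (fraction c d _) (fraction e f _) =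
      solve 6 (λ a b c d e f →
        ((a :* c) :* e) :* (b :* (d :* f)) := (a :* (c :* e)) :* ((b :* d) :* f)) refl a b c d e f

    distribʳᶠ : ∀ r p q → ((p +ᶠ q) *ᶠ r) ≈ᶠ ((p *ᶠ r) +ᶠ (q *ᶠ r))
    distribʳᶠ (fraction e f _) (fraction a b _) (fraction c d _) =
      solve 6 (λ a b c d e f →
        ((a :* d :+ c :* b) :* e) :* ((b :* f) :* (d :* f))
        := ((a :* e) :* (d :* f) :+ (c :* e) :* (b :* f)) :* ((b :* d) :* f)) refl a b c d e f

    +ᶠ-identityʳ : ∀ p → (p +ᶠ 0ᶠ) ≈ᶠ p
    +ᶠ-identityʳ p = ≈ᶠ-trans {p +ᶠ 0ᶠ} {0ᶠ +ᶠ p} {p} (+ᶠ-comm p 0ᶠ) (+ᶠ-identityˡ p)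

    *ᶠ-identityʳ : ∀ p → (p *ᶠ 1ᶠ) ≈ᶠ p
    *ᶠ-identityʳ p = ≈ᶠ-trans {p *ᶠ 1ᶠ} {1ᶠ *ᶠ p} {p} (*ᶠ-comm p 1ᶠ) (*ᶠ-identityˡ p)

    -ᶠ-inverseʳ : ∀ p → (p +ᶠ (-ᶠ p)) ≈ᶠ 0ᶠ
    -ᶠ-inverseʳ p =
      ≈ᶠ-trans {p +ᶠ (-ᶠ p)} {(-ᶠ p) +ᶠ p} {0ᶠ} (+ᶠ-comm p (-ᶠ p)) (-ᶠ-inverseˡ p)

    distribˡᶠ : ∀ r p q → (r *ᶠ (p +ᶠ q)) ≈ᶠ ((r *ᶠ p) +ᶠ (r *ᶠ q))
    distribˡᶠ r p q =
      ≈ᶠ-trans {r *ᶠ (p +ᶠ q)} {(p +ᶠ q) *ᶠ r} {(r *ᶠ p) +ᶠ (r *ᶠ q)} (*ᶠ-comm r (p +ᶠ q))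
        (≈ᶠ-trans {(p +ᶠ q) *ᶠ r} {(p *ᶠ r) +ᶠ (q *ᶠ r)} {(r *ᶠ p) +ᶠ (r *ᶠ q)} (distribʳᶠ r p q)
          (+ᶠ-cong {p *ᶠ r} {r *ᶠ p} {q *ᶠ r} {r *ᶠ q} (*ᶠ-comm p r) (*ᶠ-comm q r)))

  fractionRing : CommutativeRing (c ⊔ ℓ′) ℓ
  fractionRing = record
    { Carrier = Fraction
    ; _≈_ = _≈ᶠ_
    ; _+_ = _+ᶠ_
    ; _*_ = _*ᶠ_
    ; -_ = -ᶠ_
    ; 0# = 0ᶠ
    ; 1# = 1ᶠ
    ; isCommutativeRing = record
      { isRing = record
        { +-isAbelianGroup = record
          { isGroup = record
            { isMonoid = record
              { isSemigroup = record
                { isMagma = record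
                  { isEquivalence = record
                    { refl = refl
                    ; sym = sym
                    ; trans = λ {p} {q} {r} → ≈ᶠ-trans {p} {q} {r}
                    }
                  ; ∙-cong = λ {p} {p′} {q} {q′} → +ᶠ-cong {p} {p′} {q} {q′}
                  }
                ; assoc = +ᶠ-assoc
                }
              ; identity = +ᶠ-identityˡ , +ᶠ-identityʳ
              }
            ; inverse = -ᶠ-inverseˡ , -ᶠ-inverseʳ
            ; ⁻¹-cong = λ {p} {q} → -ᶠ-cong {p} {q}
            }
          ; comm = +ᶠ-comm
          }
        ; *-cong = λ {p} {p′} {q} {q′} → *ᶠ-cong {p} {p′} {q} {q′}
        ; *-assoc = *ᶠ-assoc
        ; *-identity = *ᶠ-identityˡ , *ᶠ-identityʳ
        ; distrib = distribˡᶠ , distribʳᶠ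
        }
      ; *-comm = *ᶠ-comm
      }
    }

  fraction-isApartDomain : IsApartDomain fractionRing (NonZero ∘ num)
  fraction-isApartDomain = record
    { nz-cong = λ {p} {q} eq nz → nz-*⁻ˡ (nz-cong eq (nz-* nz (den-nz q)))
    ; nz-1 = nz-1
    ; nz-+ = λ nz → Sum.map nz-*⁻ˡ nz-*⁻ˡ (nz-+ nz)
    ; nz-* = nz-*
    ; nz-*⁻ˡ = nz-*⁻ˡ
    ; ¬nz-0 = ¬nz-0
    ; ¬nz⇒≈0 = λ ¬nz → trans (*-congʳ (¬nz⇒≈0 ¬nz)) (trans (zeroˡ _) (sym (zeroˡ _)))
    }

fractionField : (R : CommutativeRing c ℓ) {NonZero : CommutativeRing.Carrier R → Set ℓ′} →
                IsApartDomain R NonZero → HeytingField (c ⊔ ℓ′) ℓ ℓ′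
fractionField R {NonZero} dom =
  heytingField (fractionRing R dom) (fraction-isApartDomain R dom) (λ {p} → inverse {p})
  where
  open CommutativeRing R
  open AlgebraDefinitions (CommutativeRing._≈_ (fractionRing R dom)) using (Invertible)

  inverse : ∀ {p} → NonZero (Fraction.num p) →
            Invertible (CommutativeRing.1# (fractionRing R dom)) (CommutativeRing._*_ (fractionRing R dom)) p
  inverse {fraction a b b≠0} a≠0 =
    fraction b a a≠0
    , trans (*-identityʳ _) (trans (*-comm b a) (sym (*-identityˡ _)))
    , trans (*-identityʳ _) (trans (*-comm a b) (sym (*-identityˡ _)))

-- A polynomial is the list of its coefficients, constant term first; trailing
-- zeros are permitted, so equality compares coefficients.
module Polynomials (R : CommutativeRing c ℓ) where
  open CommutativeRing R hiding (zero)
  private module R where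
    open RingProperties ring public
    open SemiringSolver commutativeSemiring public

  Polynomial : Set c
  Polynomial = List Carrier

  coeff : Polynomial → ℕ → Carrier
  coeff []      _       = 0#
  coeff (a ∷ p) zero    = a
  coeff (a ∷ p) (suc k) = coeff p k

  infix  4 _≈ᴾ_
  infixl 6 _+ᴾ_
  infixl 7 _*ᴾ_ _·_
  infix  8 -ᴾ_

  -- A record rather than a bare function type, so that both sides can be inferred.
  record _≈ᴾ_ (p q : Polynomial) : Set ℓ where
    constructor coeffwise
    field
      at : ∀ k → coeff p k ≈ coeff q k

  open _≈ᴾ_ public

  _+ᴾ_ : Polynomial → Polynomial → Polynomial
  []      +ᴾ q       = q
  (a ∷ p) +ᴾ []      = a ∷ p
  (a ∷ p) +ᴾ (b ∷ q) = (a + b) ∷ (p +ᴾ q)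

  -ᴾ_ : Polynomial → Polynomial
  -ᴾ p = map -_ p

  _·_ : Carrier → Polynomial → Polynomial
  a · p = map (a *_) p

  _*ᴾ_ : Polynomial → Polynomial → Polynomial
  []      *ᴾ q = []
  (a ∷ p) *ᴾ q = (a · q) +ᴾ (0# ∷ (p *ᴾ q))

  coeff-+ : ∀ p q k → coeff (p +ᴾ q) k ≈ coeff p k + coeff q k
  coeff-+ []      q       k       = sym (+-identityˡ _)
  coeff-+ (a ∷ p) []      k       = sym (+-identityʳ _)
  coeff-+ (a ∷ p) (b ∷ q) zero    = refl
  coeff-+ (a ∷ p) (b ∷ q) (suc k) = coeff-+ p q k

  coeff-neg : ∀ p k → coeff (-ᴾ p) k ≈ - coeff p k
  coeff-neg []      k       = sym R.-0#≈0#
  coeff-neg (a ∷ p) zero    = refl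
  coeff-neg (a ∷ p) (suc k) = coeff-neg p k

  coeff-· : ∀ a p k → coeff (a · p) k ≈ a * coeff p k
  coeff-· a []      k       = sym (zeroʳ a)
  coeff-· a (b ∷ p) zero    = refl
  coeff-· a (b ∷ p) (suc k) = coeff-· a p k

  ≈ᴾ-refl : ∀ {p} → p ≈ᴾ p
  ≈ᴾ-refl = coeffwise λ _ → refl

  ≈ᴾ-sym : ∀ {p q} → p ≈ᴾ q → q ≈ᴾ p
  ≈ᴾ-sym e = coeffwise λ k → sym (at e k)

  ≈ᴾ-trans : ∀ {p q r} → p ≈ᴾ q → q ≈ᴾ r → p ≈ᴾ r
  ≈ᴾ-trans e f = coeffwise λ k → trans (at e k) (at f k)

  via-+ : ∀ {p q r s} → (∀ k → coeff p k + coeff q k ≈ coeff r k + coeff s k) → p +ᴾ q ≈ᴾ r +ᴾ s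
  via-+ {p} {q} {r} {s} f = coeffwise λ k → trans (coeff-+ p q k) (trans (f k) (sym (coeff-+ r s k)))

  +ᴾ-cong : ∀ {p p′ q q′} → p ≈ᴾ p′ → q ≈ᴾ q′ → p +ᴾ q ≈ᴾ p′ +ᴾ q′
  +ᴾ-cong {p} {p′} {q} {q′} e f = via-+ {p} {q} {p′} {q′} λ k → +-cong (at e k) (at f k)

  +ᴾ-assoc : ∀ p q r → (p +ᴾ q) +ᴾ r ≈ᴾ p +ᴾ (q +ᴾ r)
  +ᴾ-assoc p q r = via-+ {p +ᴾ q} {r} {p} {q +ᴾ r} λ k →
    trans (+-congʳ (coeff-+ p q k)) (trans (+-assoc _ _ _) (+-congˡ (sym (coeff-+ q r k))))

  +ᴾ-comm : ∀ p q → p +ᴾ q ≈ᴾ q +ᴾ p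
  +ᴾ-comm p q = via-+ {p} {q} {q} {p} λ k → +-comm _ _

  +ᴾ-identityʳ : ∀ p → p +ᴾ [] ≈ᴾ p
  +ᴾ-identityʳ p = coeffwise λ k → trans (coeff-+ p [] k) (+-identityʳ _)

  -ᴾ-inverseˡ : ∀ p → (-ᴾ p) +ᴾ p ≈ᴾ []
  -ᴾ-inverseˡ p = coeffwise λ k →
    trans (coeff-+ (-ᴾ p) p k) (trans (+-congʳ (coeff-neg p k)) (-‿inverseˡ _))

  ∷-cong : ∀ {a b p q} → a ≈ b → p ≈ᴾ q → a ∷ p ≈ᴾ b ∷ q
  ∷-cong e f = coeffwise λ { zero → e ; (suc k) → at f k }

  0∷[] : 0# ∷ [] ≈ᴾ []
  0∷[] = coeffwise λ { zero → refl ; (suc k) → refl }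

  ·-congˡ : ∀ a {p q} → p ≈ᴾ q → a · p ≈ᴾ a · q
  ·-congˡ a {p} {q} e = coeffwise λ k →
    trans (coeff-· a p k) (trans (*-congˡ (at e k)) (sym (coeff-· a q k)))

  0·≈[] : ∀ p → 0# · p ≈ᴾ []
  0·≈[] p = coeffwise λ k → trans (coeff-· 0# p k) (zeroˡ _)

  1·≈ : ∀ p → 1# · p ≈ᴾ p
  1·≈ p = coeffwise λ k → trans (coeff-· 1# p k) (*-identityˡ _)

  ·-distribʳ : ∀ a b p → (a + b) · p ≈ᴾ (a · p) +ᴾ (b · p)
  ·-distribʳ a b p = coeffwise λ k →
    trans (coeff-· (a + b) p k) (trans (distribʳ _ a b)
      (trans (+-cong (sym (coeff-· a p k)) (sym (coeff-· b p k))) (sym (coeff-+ (a · p) (b · p) k))))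

  ·-distribˡ : ∀ a p q → a · (p +ᴾ q) ≈ᴾ (a · p) +ᴾ (a · q)
  ·-distribˡ a p q = coeffwise λ k →
    trans (coeff-· a (p +ᴾ q) k) (trans (*-congˡ (coeff-+ p q k)) (trans (distribˡ a _ _)
      (trans (+-cong (sym (coeff-· a p k)) (sym (coeff-· a q k))) (sym (coeff-+ (a · p) (a · q) k)))))

  ·-assoc : ∀ a b p → (a * b) · p ≈ᴾ a · (b · p)
  ·-assoc a b p = coeffwise λ k →
    trans (coeff-· (a * b) p k) (trans (*-assoc a b _)
      (trans (*-congˡ (sym (coeff-· b p k))) (sym (coeff-· a (b · p) k))))

  interchange : ∀ p q r s → (p +ᴾ q) +ᴾ (r +ᴾ s) ≈ᴾ (p +ᴾ r) +ᴾ (q +ᴾ s)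
  interchange p q r s = via-+ {p +ᴾ q} {r +ᴾ s} {p +ᴾ r} {q +ᴾ s} λ k →
    trans (+-cong (coeff-+ p q k) (coeff-+ r s k))
      (trans (R.solve 4 (λ p q r s → (p R.:+ q) R.:+ (r R.:+ s) R.:= (p R.:+ r) R.:+ (q R.:+ s)) refl
                (coeff p k) (coeff q k) (coeff r k) (coeff s k))
        (+-cong (sym (coeff-+ p r k)) (sym (coeff-+ q s k))))

  0∷-+ : ∀ p q → 0# ∷ (p +ᴾ q) ≈ᴾ (0# ∷ p) +ᴾ (0# ∷ q)
  0∷-+ p q = ∷-cong (sym (+-identityˡ 0#)) ≈ᴾ-refl

  *ᴾ-congˡ : ∀ p {q q′} → q ≈ᴾ q′ → p *ᴾ q ≈ᴾ p *ᴾ q′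
  *ᴾ-congˡ []      e = ≈ᴾ-refl
  *ᴾ-congˡ (a ∷ p) e = +ᴾ-cong (·-congˡ a e) (∷-cong refl (*ᴾ-congˡ p e))

  *ᴾ-zeroʳ : ∀ p → p *ᴾ [] ≈ᴾ []
  *ᴾ-zeroʳ []      = ≈ᴾ-refl
  *ᴾ-zeroʳ (a ∷ p) = ≈ᴾ-trans (∷-cong refl (*ᴾ-zeroʳ p)) 0∷[]

  *ᴾ-∷ʳ : ∀ p b q → p *ᴾ (b ∷ q) ≈ᴾ (b · p) +ᴾ (0# ∷ (p *ᴾ q))
  *ᴾ-∷ʳ []      b q = ≈ᴾ-sym 0∷[]
  *ᴾ-∷ʳ (a ∷ p) b q =
    ∷-cong (+-congʳ (*-comm a b))
      (≈ᴾ-trans (+ᴾ-cong ≈ᴾ-refl (*ᴾ-∷ʳ p b q))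
        (≈ᴾ-trans (≈ᴾ-sym (+ᴾ-assoc (a · q) (b · p) (0# ∷ (p *ᴾ q))))
          (≈ᴾ-trans (+ᴾ-cong (+ᴾ-comm (a · q) (b · p)) ≈ᴾ-refl)
            (+ᴾ-assoc (b · p) (a · q) (0# ∷ (p *ᴾ q))))))

  *ᴾ-comm : ∀ p q → p *ᴾ q ≈ᴾ q *ᴾ p
  *ᴾ-comm []      q = ≈ᴾ-sym (*ᴾ-zeroʳ q)
  *ᴾ-comm (a ∷ p) q =
    ≈ᴾ-trans (+ᴾ-cong ≈ᴾ-refl (∷-cong refl (*ᴾ-comm p q))) (≈ᴾ-sym (*ᴾ-∷ʳ q a p))

  *ᴾ-cong : ∀ {p p′ q q′} → p ≈ᴾ p′ → q ≈ᴾ q′ → p *ᴾ q ≈ᴾ p′ *ᴾ q′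
  *ᴾ-cong {p} {p′} {q} {q′} e f =
    ≈ᴾ-trans (*ᴾ-congˡ p f)
      (≈ᴾ-trans (*ᴾ-comm p q′) (≈ᴾ-trans (*ᴾ-congˡ q′ e) (*ᴾ-comm q′ p′)))

  *ᴾ-distribʳ : ∀ r p q → (p +ᴾ q) *ᴾ r ≈ᴾ (p *ᴾ r) +ᴾ (q *ᴾ r)
  *ᴾ-distribʳ r []      q       = ≈ᴾ-refl
  *ᴾ-distribʳ r (a ∷ p) []      = ≈ᴾ-sym (+ᴾ-identityʳ _)
  *ᴾ-distribʳ r (a ∷ p) (b ∷ q) =
    ≈ᴾ-trans (+ᴾ-cong (·-distribʳ a b r)
                (≈ᴾ-trans (∷-cong refl (*ᴾ-distribʳ r p q)) (0∷-+ (p *ᴾ r) (q *ᴾ r))))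
      (interchange (a · r) (b · r) (0# ∷ (p *ᴾ r)) (0# ∷ (q *ᴾ r)))

  *ᴾ-distribˡ : ∀ r p q → r *ᴾ (p +ᴾ q) ≈ᴾ (r *ᴾ p) +ᴾ (r *ᴾ q)
  *ᴾ-distribˡ r p q =
    ≈ᴾ-trans (*ᴾ-comm r (p +ᴾ q))
      (≈ᴾ-trans (*ᴾ-distribʳ r p q) (+ᴾ-cong (*ᴾ-comm p r) (*ᴾ-comm q r)))

  ·-*ᴾ : ∀ a q r → (a · q) *ᴾ r ≈ᴾ a · (q *ᴾ r)
  ·-*ᴾ a []      r = ≈ᴾ-refl
  ·-*ᴾ a (b ∷ q) r =
    ≈ᴾ-trans (+ᴾ-cong (·-assoc a b r) (∷-cong (sym (zeroʳ a)) (·-*ᴾ a q r)))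
      (≈ᴾ-sym (·-distribˡ a (b · r) (0# ∷ (q *ᴾ r))))

  0∷-*ᴾ : ∀ p r → (0# ∷ p) *ᴾ r ≈ᴾ 0# ∷ (p *ᴾ r)
  0∷-*ᴾ p r = +ᴾ-cong (0·≈[] r) ≈ᴾ-refl

  *ᴾ-assoc : ∀ p q r → (p *ᴾ q) *ᴾ r ≈ᴾ p *ᴾ (q *ᴾ r)
  *ᴾ-assoc []      q r = ≈ᴾ-refl
  *ᴾ-assoc (a ∷ p) q r =
    ≈ᴾ-trans (*ᴾ-distribʳ r (a · q) (0# ∷ (p *ᴾ q)))
      (+ᴾ-cong (·-*ᴾ a q r)
        (≈ᴾ-trans (0∷-*ᴾ (p *ᴾ q) r) (∷-cong refl (*ᴾ-assoc p q r))))

  *ᴾ-identityˡ : ∀ p → (1# ∷ []) *ᴾ p ≈ᴾ p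
  *ᴾ-identityˡ p = ≈ᴾ-trans (+ᴾ-cong (1·≈ p) 0∷[]) (+ᴾ-identityʳ p)

  polynomialRing : CommutativeRing c ℓ
  polynomialRing = record
    { Carrier = Polynomial
    ; _≈_ = _≈ᴾ_
    ; _+_ = _+ᴾ_
    ; _*_ = _*ᴾ_
    ; -_ = -ᴾ_
    ; 0# = []
    ; 1# = 1# ∷ []
    ; isCommutativeRing = record
      { isRing = record
        { +-isAbelianGroup = record
          { isGroup = record
            { isMonoid = record
              { isSemigroup = record
                { isMagma = record
                  { isEquivalence = record { refl = ≈ᴾ-refl ; sym = ≈ᴾ-sym ; trans = ≈ᴾ-trans }
                  ; ∙-cong = +ᴾ-cong
                  }
                ; assoc = +ᴾ-assoc
                }
              ; identity = (λ p → ≈ᴾ-refl) , +ᴾ-identityʳ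
              }
            ; inverse = -ᴾ-inverseˡ , λ p → ≈ᴾ-trans (+ᴾ-comm p (-ᴾ p)) (-ᴾ-inverseˡ p)
            ; ⁻¹-cong = λ {p} {q} e → coeffwise λ k →
                trans (coeff-neg p k) (trans (-‿cong (at e k)) (sym (coeff-neg q k)))
            }
          ; comm = +ᴾ-comm
          }
        ; *-cong = *ᴾ-cong
        ; *-assoc = *ᴾ-assoc
        ; *-identity = *ᴾ-identityˡ , λ p → ≈ᴾ-trans (*ᴾ-comm p (1# ∷ [])) (*ᴾ-identityˡ p)
        ; distrib = *ᴾ-distribˡ , *ᴾ-distribʳ
        }
      ; *-comm = *ᴾ-comm
      }
    }

ringOf : HeytingField c ℓ ℓ′ → CommutativeRing c ℓ
ringOf K = HeytingCommutativeRing.commutativeRing (HeytingField.heytingCommutativeRing K)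

field-isApartDomain : (K : HeytingField c ℓ ℓ′) →
                      IsApartDomain (ringOf K) (λ x → HeytingField._#_ K x (HeytingField.0# K))
field-isApartDomain K = record
  { nz-cong = #-congʳ
  ; nz-1 = 1#0
  ; nz-+ = nz-+
  ; nz-* = x#0y#0→xy#0
  ; nz-*⁻ˡ = λ {x} {y} xy#0 → factor-invertible x y (#⇒invertible xy#0)
  ; ¬nz-0 = #-irrefl refl
  ; ¬nz⇒≈0 = λ {x} → proj₁ (tight x 0#)
  }
  where
  open HeytingField K
  open HeytingProperties heytingCommutativeRing
  open AlgebraDefinitions _≈_ using (Invertible)
  open SetoidReasoning setoid

  nz-+ : ∀ {x y} → x + y # 0# → x # 0# ⊎ y # 0#
  nz-+ {x} {y} p with #-cotrans p y
  ... | inj₂ y#0   = inj₂ y#0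
  ... | inj₁ x+y#y = inj₁ (invertible⇒# (shift (#⇒invertible x+y#y)))
    where
    eq : x - 0# ≈ (x + y) - y
    eq = begin
      x - 0#           ≈⟨ x-0≈x x ⟩
      x                ≈⟨ +-identityʳ x ⟨
      x + 0#           ≈⟨ +-congˡ (-‿inverseʳ y) ⟨
      x + (y - y)      ≈⟨ +-assoc x y (- y) ⟨
      (x + y) - y      ∎

    shift : Invertible 1# _*_ ((x + y) - y) → Invertible 1# _*_ (x - 0#)
    shift (w , left , right) = w , trans (*-congˡ eq) left , trans (*-congʳ eq) right

  factor-invertible : ∀ x y → Invertible 1# _*_ (x * y - 0#) → x # 0#
  factor-invertible x y (w , _ , right) = invertibleʳ⇒# (y * w , (begin
    (x - 0#) * (y * w)      ≈⟨ *-congʳ (x-0≈x x) ⟩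
    x * (y * w)             ≈⟨ *-assoc x y w ⟨
    (x * y) * w             ≈⟨ *-congʳ (x-0≈x (x * y)) ⟨
    (x * y - 0#) * w        ≈⟨ right ⟩
    1#                      ∎))

module _ {R : CommutativeRing c ℓ} {NonZero : CommutativeRing.Carrier R → Set ℓ′}
         (dom : IsApartDomain R NonZero) where
  open CommutativeRing R hiding (zero)
  open IsApartDomain dom
  open RingProperties ring
  open Polynomials R
  open SetoidReasoning setoid

  SomeCoeff : Polynomial → Set ℓ′
  SomeCoeff p = ∃[ k ] NonZero (coeff p k)

  private
    nz-split : ∀ {x y} → NonZero y → NonZero (x + y) ⊎ NonZero x
    nz-split {x} {y} nz = Sum.map₂ (λ nz′ → nz-*⁻ˡ {y = - 1#} (nz-cong neg nz′)) (nz-+ (nz-cong eq nz))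
      where
      eq : y ≈ (x + y) + - x
      eq = begin
        y                  ≈⟨ +-identityʳ y ⟨
        y + 0#             ≈⟨ +-congˡ (-‿inverseʳ x) ⟨
        y + (x - x)        ≈⟨ +-assoc y x (- x) ⟨
        (y + x) - x        ≈⟨ +-congʳ (+-comm y x) ⟩
        (x + y) - x        ∎

      neg : - x ≈ x * - 1#
      neg = begin
        - x            ≈⟨ -‿cong (*-identityʳ x) ⟨
        - (x * 1#)     ≈⟨ -‿distribʳ-* x 1# ⟩
        x * - 1#       ∎

    someCoeff-split : ∀ a p r k → NonZero (coeff r k) →
                      SomeCoeff ((a · p) +ᴾ (0# ∷ r)) ⊎ NonZero a
    someCoeff-split a p r k nz =
      Sum.map (λ nz′ → suc k , nz-cong (sym (coeff-+ (a · p) (0# ∷ r) (suc k))) nz′)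
              (λ nz′ → nz-*⁻ˡ (nz-cong (coeff-· a p (suc k)) nz′))
              (nz-split nz)

    someCoeff-cong : ∀ {p q} → p ≈ᴾ q → SomeCoeff p → SomeCoeff q
    someCoeff-cong e (k , nz) = k , nz-cong (at e k) nz

    -- Some coefficient of p *ᴾ q is apart from 0, though not necessarily the
    -- (i + j)-th: a failure there exhibits a coefficient of lower index.
    someCoeff-* : ∀ p q i j → NonZero (coeff p i) → NonZero (coeff q j) → SomeCoeff (p *ᴾ q)
    someCoeff-* []      q       i       j       nzp nzq = ⊥-elim (¬nz-0 nzp)
    someCoeff-* (a ∷ p) []      i       j       nzp nzq = ⊥-elim (¬nz-0 nzq)
    someCoeff-* (a ∷ p) (b ∷ q) zero    zero    nzp nzq =
      zero , nz-cong (sym (+-identityʳ _)) (nz-* nzp nzq)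
    someCoeff-* (a ∷ p) (b ∷ q) (suc i) zero    nzp nzq
      with someCoeff-* p (b ∷ q) i zero nzp nzq
    ... | k , nz with someCoeff-split a (b ∷ q) (p *ᴾ (b ∷ q)) k nz
    ...   | inj₁ found = found
    ...   | inj₂ nza   = someCoeff-* (a ∷ p) (b ∷ q) zero zero nza nzq
    someCoeff-* (a ∷ p) (b ∷ q) i       (suc j) nzp nzq
      with someCoeff-* (a ∷ p) q i j nzp nzq
    ... | k , nz with someCoeff-split b (a ∷ p) ((a ∷ p) *ᴾ q) k nz
    ...   | inj₁ found = someCoeff-cong (≈ᴾ-sym (*ᴾ-∷ʳ (a ∷ p) b q)) found
    ...   | inj₂ nzb   = someCoeff-* (a ∷ p) (b ∷ q) i zero nzp nzb

    someCoeff-*⁻ˡ : ∀ p q k → NonZero (coeff (p *ᴾ q) k) → SomeCoeff p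
    someCoeff-*⁻ˡ []      q k       nz = ⊥-elim (¬nz-0 nz)
    someCoeff-*⁻ˡ (a ∷ p) q k       nz
      with nz-+ (nz-cong (coeff-+ (a · q) (0# ∷ (p *ᴾ q)) k) nz)
    ... | inj₁ nz′ = zero , nz-*⁻ˡ (nz-cong (coeff-· a q k) nz′)
    someCoeff-*⁻ˡ (a ∷ p) q zero    nz | inj₂ nz′ = ⊥-elim (¬nz-0 nz′)
    someCoeff-*⁻ˡ (a ∷ p) q (suc k) nz | inj₂ nz′ with someCoeff-*⁻ˡ p q k nz′
    ... | j , nzp = suc j , nzp

  polynomial-isApartDomain : IsApartDomain polynomialRing SomeCoeff
  polynomial-isApartDomain = record
    { nz-cong = someCoeff-cong
    ; nz-1 = zero , nz-1
    ; nz-+ = λ {p} {q} (k , nz) → Sum.map (k ,_) (k ,_) (nz-+ (nz-cong (coeff-+ p q k) nz))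
    ; nz-* = λ {p} {q} (i , nzp) (j , nzq) → someCoeff-* p q i j nzp nzq
    ; nz-*⁻ˡ = λ {p} {q} (k , nz) → someCoeff-*⁻ˡ p q k nz
    ; ¬nz-0 = λ (_ , nz) → ¬nz-0 nz
    ; ¬nz⇒≈0 = λ ¬nz → coeffwise λ k → ¬nz⇒≈0 λ nz → ¬nz (k , nz)
    }

-- K(s): quotients of polynomials over K, the denominator having a coefficient
-- apart from 0.
module _ (K : HeytingField c ℓ ℓ′) where
  private
    domain : IsApartDomain (Polynomials.polynomialRing (ringOf K)) (SomeCoeff (field-isApartDomain K))
    domain = polynomial-isApartDomain (field-isApartDomain K)

  RationalFunctions : HeytingField (c ⊔ ℓ′) ℓ ℓ′
  RationalFunctions = fractionField (Polynomials.polynomialRing (ringOf K)) domain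

  fromPolynomial : List (HeytingField.Carrier K) → HeytingField.Carrier RationalFunctions
  fromPolynomial p = fraction p (HeytingField.1# K ∷ []) (IsApartDomain.nz-1 domain)

  constant : HeytingField.Carrier K → HeytingField.Carrier RationalFunctions
  constant a = fromPolynomial (a ∷ [])

  indeterminate : HeytingField.Carrier RationalFunctions
  indeterminate = fromPolynomial (HeytingField.0# K ∷ HeytingField.1# K ∷ [])

-- F(z₀, …, z₍ₖ₋₁₎), adjoining one indeterminate at a time; for k = 0 it is F.
RationalFunctionsIn : ℕ → HeytingField ℓ ℓ ℓ → HeytingField ℓ ℓ ℓ
RationalFunctionsIn zero    F = F
RationalFunctionsIn (suc k) F = RationalFunctions (RationalFunctionsIn k F)

module _ (F : HeytingField ℓ ℓ ℓ) where

  constantIn : ∀ k → HeytingField.Carrier F → HeytingField.Carrier (RationalFunctionsIn k F)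
  constantIn zero    a = a
  constantIn (suc k) a = constant (RationalFunctionsIn k F) (constantIn k a)

  indeterminateIn : ∀ {k} → Fin k → HeytingField.Carrier (RationalFunctionsIn k F)
  indeterminateIn {suc k} zero    = indeterminate (RationalFunctionsIn k F)
  indeterminateIn {suc k} (suc i) = constant (RationalFunctionsIn k F) (indeterminateIn i)

------------------------------------------------------------------------
-- Matrices

module Matrices (R : CommutativeRing c ℓ) where
  open CommutativeRing R
  open MonoidSum +-monoid using (sum)

  Matrix : ℕ → ℕ → Set c
  Matrix m n = Fin m → Fin n → Carrier

  infix  4 _≈ᴹ_
  infixl 7 _*ᴹ_ _*ᵛ_

  _≈ᴹ_ : ∀ {m n} → Matrix m n → Matrix m n → Set ℓ
  M ≈ᴹ N = ∀ i j → M i j ≈ N i j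

  _*ᴹ_ : ∀ {m n p} → Matrix m n → Matrix n p → Matrix m p
  (M *ᴹ N) i j = sum λ k → M i k * N k j

  _*ᵛ_ : ∀ {m n} → Matrix m n → Vector Carrier n → Vector Carrier m
  (M *ᵛ v) i = sum λ k → M i k * v k

  identity : ∀ {n} → Matrix n n
  identity i j = if does (i ≟ j) then 1# else 0#

  IsInverse : ∀ {n} → Matrix n n → Matrix n n → Set ℓ
  IsInverse M N = M *ᴹ N ≈ᴹ identity × N *ᴹ M ≈ᴹ identity

  IsInvertible : ∀ {n} → Matrix n n → Set (c ⊔ ℓ)
  IsInvertible M = ∃ (IsInverse M)

------------------------------------------------------------------------
-- Signal flow graphs

-- The branches are indexed by Fin n ⊎ Fin #zeroOrder: inj₁ i is the i-th
-- first-order branch, the others are the zero-order branches of gain 1.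
record BranchGraph (n : ℕ) : Set where
  field
    #nodes         : ℕ
    #zeroOrder     : ℕ
    source target  : Fin n ⊎ Fin #zeroOrder → Fin #nodes

  Node : Set
  Node = Fin #nodes

  Branch : Set
  Branch = Fin n ⊎ Fin #zeroOrder

  branches : List Branch
  branches = map inj₁ (allFin n) ++ map inj₂ (allFin #zeroOrder)

  entering leaving : Node → List Branch
  entering v = filter (λ e → target e ≟ v) branches
  leaving  v = filter (λ e → source e ≟ v) branches

  inDegree outDegree : Node → ℕ
  inDegree  v = length (entering v)
  outDegree v = length (leaving v)

  Adjacent : Node → Node → Set
  Adjacent v w = ∃[ e ] source e ≡ v × target e ≡ w

  Walk : Node → Node → Set
  Walk = Star Adjacent

  nodes : ∀ {v w} → Walk v w → List Node
  nodes {v} ε       = v ∷ []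
  nodes {v} (_ ◅ p) = v ∷ nodes p

  Path : Node → Node → Set
  Path v w = Σ (Walk v w) λ p → Unique (nodes p)

record SignalFlowGraph (n : ℕ) : Set where
  field
    branchGraph : BranchGraph n

  open BranchGraph branchGraph public

  field
    noParallel : ∀ {e e′} → source e ≡ source e′ → target e ≡ target e′ → e ≡ e′
    noSelfLoop : ∀ e → source e ≢ target e

    -- The node joining two branches in series carries no other branch.
    series : ∀ i → let v = target (inj₁ i) in
             inDegree v ≡ 1 × outDegree v ≡ 1 × ∃[ j ] source (inj₂ j) ≡ v

    input output     : Fin 2 → Node
    input-injective  : Injective _≡_ _≡_ input
    output-injective : Injective _≡_ _≡_ output
    input-inDegree   : ∀ k → inDegree (input k) ≡ 0
    output-outDegree : ∀ k → outDegree (output k) ≡ 0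

    inner-degree : ∀ v → (∀ k → v ≢ input k) → (∀ k → v ≢ output k) →
                   inDegree v ≤ 1 ⊎ outDegree v ≤ 1

  General2Path : Set
  General2Path =
    Σ (Permutation′ 2) λ π →
    Σ (Path (input (π ⟨$⟩ʳ 0F)) (output 0F)) λ P₁ →
    Σ (Path (input (π ⟨$⟩ʳ 1F)) (output 1F)) λ P₂ →
    Disjoint (nodes (proj₁ P₁)) (nodes (proj₁ P₂))

-- F stands for the real numbers, which the standard library lacks; constructive
-- real numbers form a Heyting field.
-- Each pole is one of k independent indeterminates or a constant from F. Thus
-- k = 0 is the case of constant poles, and k = n with pole = inj₁ that of
-- indeterminate poles.
record Poles (F : HeytingField ℓ ℓ ℓ) (k n : ℕ) : Set ℓ where
  field
    pole     : Fin n → Fin k ⊎ HeytingField.Carrier F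
    distinct : ∀ {i j a} → pole i ≡ inj₁ a → pole j ≡ inj₁ a → i ≡ j

  poleValue : Fin n → HeytingField.Carrier (RationalFunctionsIn k F)
  poleValue i = Sum.[ indeterminateIn F , constantIn F k ] (pole i)

module _ (K : HeytingField c ℓ ℓ′) where
  open HeytingField K
  open Matrices (ringOf K)

  record LinearSystem (n : ℕ) : Set c where
    field
      A : Matrix n n
      B : Matrix n 2
      C : Matrix 2 n

  module _ {n} (D : SignalFlowGraph n) where
    open SignalFlowGraph D

    signal : Vector Carrier n → (Node → Carrier) → Branch → Carrier
    signal x val (inj₁ i) = x i
    signal x val (inj₂ j) = val (source (inj₂ j))

    record NodeEquations (x : Vector Carrier n) (u : Vector Carrier 2) (val : Node → Carrier) :
                         Set ℓ where
      field
        at-input : ∀ k → val (input k) ≈ u k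
        at-inner : ∀ v → (∀ k → v ≢ input k) →
                   val v ≈ foldr _+_ 0# (map (signal x val) (entering v))

    -- Σ(A, B, C) arises by eliminating the node variables at fixed values of x
    -- and u: they are uniquely determined by x and u, the input of each
    -- first-order branch turns ẋᵢ = zᵢxᵢ + w into ẋ = Ax + Bu, and the output
    -- nodes carry y = Cx.
    record IsLinearSystemOf (z : Vector Carrier n) (system : LinearSystem n) : Set (c ⊔ ℓ) where
      open LinearSystem system
      field
        nodeValues     : Vector Carrier n → Vector Carrier 2 → Node → Carrier
        node-equations : ∀ x u → NodeEquations x u (nodeValues x u)
        node-unique    : ∀ x u val → NodeEquations x u val → ∀ v → val v ≈ nodeValues x u v
        state-equation : ∀ x u i → z i * x i + nodeValues x u (source (inj₁ i)) ≈ (A *ᵛ x) i + (B *ᵛ u) i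
        output-equation : ∀ x u k → nodeValues x u (output k) ≈ (C *ᵛ x) k

        A-diagonal     : ∀ i → A i i ≈ z i
        A-off-diagonal : ∀ i j → i ≢ j → A i j ≈ 0# ⊎ A i j ≈ 1#
        B-entries      : ∀ i k → B i k ≈ 0# ⊎ B i k ≈ 1#
        C-entries      : ∀ k i → C k i ≈ 0# ⊎ C k i ≈ 1#

  open HeytingField (RationalFunctions K) using () renaming (_*_ to _*ˢ_; _-_ to _-ˢ_)
  private module M = Matrices (ringOf (RationalFunctions K))

  constantMatrix : ∀ {m n} → Matrix m n → M.Matrix m n
  constantMatrix N i j = constant K (N i j)

  sI-_ : ∀ {n} → Matrix n n → M.Matrix n n
  (sI- A) i j = (indeterminate K *ˢ M.identity i j) -ˢ constant K (A i j)

  -- T = C(sI - A)⁻¹B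
  IsTransferMatrix : ∀ {n} → LinearSystem n → M.Matrix 2 2 → Set (c ⊔ ℓ ⊔ ℓ′)
  IsTransferMatrix system T =
    ∃[ N ] M.IsInverse (sI- A) N × T M.≈ᴹ (constantMatrix C M.*ᴹ N) M.*ᴹ constantMatrix B
    where open LinearSystem system

{-# OPTIONS --safe #-}
module Submission where

-- If there is no general 2-path, Menger's theorem yields a vertex through which
-- every path from the inputs to the outputs passes. Clearing the gains
-- 1 / (s - zᵢ), the node equations have a square matrix M with trivial kernel
-- over K(s). Let R be the set of vertices reached before the separating vertex.
-- The |R| columns of M indexed by R and the unit vectors of the two inputs are
-- all supported on R and the separating vertex, that is, on |R| + 1 rows, so they
-- are linearly dependent. Node values solving M x = u for the unit vectors u of the
-- inputs turn this dependency into an element of the kernel of M, hence into a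
-- vanishing one; its entries at the outputs, which lie outside R, are given by T,
-- so T has a nontrivial kernel.

open import Defs
open import Algebra.Apartness using (HeytingField)
import Algebra.Apartness.Properties.HeytingCommutativeRing as HeytingProperties
open import Algebra.Bundles using (CommutativeMonoid; CommutativeRing)
open import Algebra.Morphism.Structures using (module MonoidMorphisms)
import Algebra.Properties.CommutativeSemigroup as CommutativeSemigroupProperties
import Algebra.Properties.Monoid.Sum as MonoidSum
import Algebra.Properties.Ring as RingProperties
import Algebra.Properties.Semiring.Sum as SemiringSum
import Algebra.Solver.Ring.NaturalCoefficients.Default as SemiringSolver
open import Data.Empty using (⊥; ⊥-elim)
open import Data.Fin.Base using (Fin; zero; suc; punchIn)
open import Data.Fin.Patterns using (0F; 1F)
import Data.Fin.Permutation as Permutation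
open import Data.Fin.Properties using (_≟_; any?; suc-injective)
open import Data.List.Base using (List; []; _∷_; allFin; foldr; map)
import Data.List.Membership.DecPropositional as DecMembership
open import Data.List.Membership.Propositional using (_∈_; _∉_)
open import Data.List.Membership.Propositional.Properties using (∈-++⁺ʳ; ∈-++⁺ˡ; ∈-allFin; ∈-filter⁺; ∈-filter⁻; ∈-map⁺; ∈-map⁻)
open import Data.List.Relation.Binary.Disjoint.Propositional using (Disjoint)
open import Data.List.Relation.Binary.Subset.Propositional using (_⊆_)
open import Data.List.Relation.Unary.All as All using (All; []; _∷_)
open import Data.List.Relation.Unary.All.Properties using (¬Any⇒All¬)
open import Data.List.Relation.Unary.AllPairs using ([]; _∷_)
open import Data.List.Relation.Unary.Any using (here; there)
open import Data.List.Relation.Unary.Unique.Propositional using (Unique)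
open import Data.Nat.Base using (ℕ; zero; suc)
open import Data.Product.Base using (Σ; ∃-syntax; _×_; _,_; proj₁; proj₂)
open import Data.Sum.Base as Sum using (_⊎_; inj₁; inj₂; [_,_]′)
open import Data.Vec.Functional as Vector using (Vector)
open import Data.Vec.Functional.Properties using (insertAt-lookup; insertAt-punchIn)
open import Function.Base using (_∘_; id)
open import Level using (0ℓ; Level; _⊔_)
open import Relation.Binary.Construct.Closure.ReflexiveTransitive as Star using (Star; _◅_; _◅◅_; ε)
open import Relation.Binary.Definitions using (DecidableEquality)
open import Relation.Binary.PropositionalEquality.Core as ≡ using (_≡_; _≢_)
import Relation.Binary.Reasoning.Setoid as SetoidReasoning
open import Relation.Nullary.Decidable using (¬?)
open import Relation.Nullary.Decidable.Core using (_×-dec_; no; yes)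
open import Relation.Nullary.Negation.Core using (¬_; contradiction)
open import Relation.Unary using (Pred; Decidable; _∪_; _∩_; ∅)
open import Relation.Unary.Properties using (_∪?_; _∩?_; ∅?)

-- Equality in the field is not decidable, so pivots cannot be searched for, and linear dependence
-- is available only as the negation of a trivial kernel. This is enough because no path is
-- extracted from a contradiction: on a finite list of edges Menger's alternative is constructive,
-- and the algebra only has to refute the separation.
--
-- The kernel of M is trivial for two reasons: the inverse of sI - A makes the states vanish, and
-- the node values are determined by states and inputs. The latter is given over K, whereas M lives
-- over K(s). It carries over because zero-order branches have gain 1: the node equations are purely
-- additive, so they survive multiplication by a common denominator and passage to coefficients.
--
-- No submatrix on |R| + 1 rows is cut out. Padding by unit vectors keeps all rows, and the rows
-- outside R and the separating vertex force the padding coefficients to vanish.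

private
  variable
    c ℓ ℓ′ c₁ ℓ₁ c₂ ℓ₂ : Level

-- Menger's theorem for two sources and two sinks

module Menger {V : Set} (_≟_ : DecidableEquality V) where
  open DecMembership _≟_ using (_∈?_)

  Edges : Set
  Edges = List (V × V)

  WalkIn : Edges → V → V → Set
  WalkIn E = Star λ x y → (x , y) ∈ E

  private
    variable
      E : Edges
      x y z a₁ a₂ b₁ b₂ : V

  vertices : WalkIn E x y → List V
  vertices {x = x} ε       = x ∷ []
  vertices {x = x} (_ ◅ p) = x ∷ vertices p

  first∈ : (p : WalkIn E x y) → x ∈ vertices p
  first∈ ε       = here ≡.refl
  first∈ (_ ◅ _) = here ≡.refl

  last∈ : (p : WalkIn E x y) → y ∈ vertices p
  last∈ ε       = here ≡.refl
  last∈ (_ ◅ p) = there (last∈ p)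

  ∈-◅◅⁻ : (p : WalkIn E x y) (q : WalkIn E y z) → ∀ {w} →
          w ∈ vertices (p ◅◅ q) → w ∈ vertices p ⊎ w ∈ vertices q
  ∈-◅◅⁻ ε       q w∈            = inj₂ w∈
  ∈-◅◅⁻ (_ ◅ p) q (here ≡.refl)   = inj₁ (here ≡.refl)
  ∈-◅◅⁻ (_ ◅ p) q (there w∈)    = Sum.map₁ there (∈-◅◅⁻ p q w∈)

  weaken : ∀ {e} → WalkIn E x y → WalkIn (e ∷ E) x y
  weaken = Star.map there

  vertices-weaken : ∀ {e} (p : WalkIn E x y) → vertices (weaken {e = e} p) ≡ vertices p
  vertices-weaken ε       = ≡.refl
  vertices-weaken {x = x} {e = e} (_ ◅ p) rewrite vertices-weaken {e = e} p = ≡.refl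

  -- Vertices may repeat within a walk. Walks can be concatenated freely, and erasing loops
  -- afterwards only shrinks the vertex sets, so disjointness is not lost.
  DisjointWalks : Edges → (a₁ b₁ a₂ b₂ : V) → Set
  DisjointWalks E a₁ b₁ a₂ b₂ =
    Σ (WalkIn E a₁ b₁) λ p → Σ (WalkIn E a₂ b₂) λ q → Disjoint (vertices p) (vertices q)

  swapWalks : DisjointWalks E a₁ b₁ a₂ b₂ → DisjointWalks E a₂ b₂ a₁ b₁
  swapWalks (p , q , p∥q) = q , p , λ (∈q , ∈p) → p∥q (∈p , ∈q)

  weakenWalks : ∀ {e} → DisjointWalks E a₁ b₁ a₂ b₂ → DisjointWalks (e ∷ E) a₁ b₁ a₂ b₂
  weakenWalks {e = e} (p , q , p∥q) = weaken p , weaken q ,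
    λ (∈p , ∈q) → p∥q (≡.subst (_ ∈_) (vertices-weaken {e = e} p) ∈p , ≡.subst (_ ∈_) (vertices-weaken {e = e} q) ∈q)

  Linkage : Edges → (a₁ a₂ b₁ b₂ : V) → Set
  Linkage E a₁ a₂ b₁ b₂ = DisjointWalks E a₁ b₁ a₂ b₂ ⊎ DisjointWalks E a₂ b₁ a₁ b₂

  -- Every walk from a₁ or a₂ to b₁ or b₂ meets the cut vertex: it starts in
  -- Near⁺, ends outside Near, and can leave Near only into the cut.
  record Separation (E : Edges) (a₁ a₂ b₁ b₂ : V) : Set₁ where
    field
      cut  : V
      Near : Pred V 0ℓ
      near? : Decidable Near

    Near⁺ : Pred V 0ℓ
    Near⁺ = Near ∪ (_≡ cut)

    field
      closed : (x , y) ∈ E → Near x → Near⁺ y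
      start₁ : Near⁺ a₁
      start₂ : Near⁺ a₂
      end₁   : ¬ Near b₁
      end₂   : ¬ Near b₂

  module _ (S : Separation E a₁ a₂ b₁ b₂) where
    open Separation S

    near-walk : (p : WalkIn E x y) → Near x → cut ∉ vertices p → All Near (vertices p)
    near-walk ε       nx cut∉ = nx ∷ []
    near-walk (e ◅ p) nx cut∉ with closed e nx
    ... | inj₁ ny   = nx ∷ near-walk p ny (cut∉ ∘ there)
    ... | inj₂ ≡.refl = contradiction (there (first∈ p)) cut∉

    far-walk : (p : WalkIn E x y) → ¬ Near y → cut ∉ vertices p → All (λ v → ¬ Near v) (vertices p)
    far-walk ε       fy cut∉ = fy ∷ []
    far-walk (e ◅ p) fy cut∉ =
      (λ nx → [ All.lookup far (first∈ p) , (λ { ≡.refl → cut∉ (there (first∈ p)) }) ]′ (closed e nx)) ∷ far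
      where far = far-walk p fy (cut∉ ∘ there)

    -- The walk is stopped as soon as `closed` reports the cut; every vertex passed before lies in
    -- `Near`.
    near-prefix : (p : WalkIn E x cut) → Near⁺ x →
                  Σ (WalkIn E x cut) λ q → All (λ v → v ∈ vertices p × Near⁺ v) (vertices q)
    near-prefix ε       nx = ε , (here ≡.refl , nx) ∷ []
    near-prefix (e ◅ p) (inj₂ ≡.refl) = ε , (here ≡.refl , inj₂ ≡.refl) ∷ []
    near-prefix (e ◅ p) (inj₁ nx) with near-prefix p (closed e nx)
    ... | q , within = e ◅ q , (here ≡.refl , inj₁ nx) ∷ All.map (λ (∈p , nv) → there ∈p , nv) within

    -- The suffix starts at the last visit to the cut. A later vertex in `Near` would force yet
    -- another visit, since the walk ends outside `Near`.
    far-suffix : (p : WalkIn E x y) → ¬ Near y → cut ∈ vertices p →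
                 Σ (WalkIn E cut y) λ q → All (λ v → v ∈ vertices p × (¬ Near v ⊎ v ≡ cut)) (vertices q)
    far-suffix ε       fy (here ≡.refl) = ε , (here ≡.refl , inj₂ ≡.refl) ∷ []
    far-suffix (e ◅ p) fy cut∈ with cut ∈? vertices p
    far-suffix (e ◅ p) fy cut∈         | yes cut∈p with far-suffix p fy cut∈p
    ... | q , within = q , All.map (λ (∈p , fv) → there ∈p , fv) within
    far-suffix (e ◅ p) fy (there cut∈) | no cut∉p = contradiction cut∈ cut∉p
    far-suffix (e ◅ p) fy (here ≡.refl)  | no cut∉p =
      e ◅ p , (here ≡.refl , inj₂ ≡.refl) ∷ All.tabulate λ ∈p → there ∈p , inj₁ (All.lookup (far-walk p fy cut∉p) ∈p)

    -- The walks through the cut may wander to the wrong side, so only a prefix of `p` inside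
    -- `Near⁺` and the suffix of `q` after its last visit to the cut are kept and glued there. The
    -- walks `p′` and `q′` avoid the cut, hence stay inside and outside `Near` respectively, and the
    -- new edge bridges them. Pieces from opposite sides could meet only at the cut, which `p′` and
    -- `q′` avoid.
    join : ∀ {s t c d} → Near⁺ s → Near⁺ t → ¬ Near c → ¬ Near d →
           DisjointWalks E s cut t x → DisjointWalks E cut c y d →
           DisjointWalks ((x , y) ∷ E) s c t d
    join {x} {y} ns nt fc fd (p , p′ , p∥p′) (q , q′ , q∥q′)
      with near-prefix p ns | far-suffix q fc (first∈ q)
    ... | r , r-within | s , s-within =
      weaken (r ◅◅ s) , weaken p′ ◅◅ here ≡.refl ◅ weaken q′ , disjoint
      where
      cut∉p′ : cut ∉ vertices p′
      cut∉p′ ∈p′ = p∥p′ (last∈ p , ∈p′)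

      near-p′ : All Near (vertices p′)
      near-p′ = near-walk p′ ([ id , (λ { ≡.refl → contradiction (first∈ p′) cut∉p′ }) ]′ nt) cut∉p′

      cut∉q′ : cut ∉ vertices q′
      cut∉q′ ∈q′ = q∥q′ (first∈ q , ∈q′)

      far-q′ : All (λ v → ¬ Near v) (vertices q′)
      far-q′ = far-walk q′ fd cut∉q′

      ∉-cross : ∀ {v} → v ∈ vertices r ⊎ v ∈ vertices s → v ∈ vertices p′ ⊎ v ∈ vertices q′ → ⊥
      ∉-cross (inj₁ ∈r) (inj₁ ∈p′) = p∥p′ (proj₁ (All.lookup r-within ∈r) , ∈p′)
      ∉-cross (inj₂ ∈s) (inj₂ ∈q′) = q∥q′ (proj₁ (All.lookup s-within ∈s) , ∈q′)
      ∉-cross (inj₁ ∈r) (inj₂ ∈q′) with proj₂ (All.lookup r-within ∈r)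
      ... | inj₁ nv   = All.lookup far-q′ ∈q′ nv
      ... | inj₂ ≡.refl = cut∉q′ ∈q′
      ∉-cross (inj₂ ∈s) (inj₁ ∈p′) with proj₂ (All.lookup s-within ∈s)
      ... | inj₁ fv   = fv (All.lookup near-p′ ∈p′)
      ... | inj₂ ≡.refl = cut∉p′ ∈p′

      ∈-weaken⁻ : ∀ {u v w} (k : WalkIn E u v) → w ∈ vertices (weaken {e = x , y} k) → w ∈ vertices k
      ∈-weaken⁻ k = ≡.subst (_ ∈_) (vertices-weaken k)

      disjoint : Disjoint (vertices (weaken {e = x , y} (r ◅◅ s)))
                          (vertices (weaken p′ ◅◅ here ≡.refl ◅ weaken q′))
      disjoint (∈rs , ∈p′q′) =
        ∉-cross (∈-◅◅⁻ r s (∈-weaken⁻ (r ◅◅ s) ∈rs))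
          ([ inj₁ ∘ ∈-weaken⁻ p′
           , (λ { (here ≡.refl) → inj₁ (last∈ p′) ; (there ∈q′) → inj₂ (∈-weaken⁻ q′ ∈q′) })
           ]′ (∈-◅◅⁻ (weaken p′) (here ≡.refl ◅ weaken q′) ∈p′q′))

  -- Menger's theorem for two pairs of vertices, by induction on the edges: if
  -- the new edge (x , y) crosses a separation, link a₁ and a₂ with {cut , x},
  -- link {cut , y} with b₁ and b₂, and join these linkages; a separation for
  -- either of these problems yields one that the new edge does not cross.
  menger : ∀ E a₁ a₂ b₁ b₂ → Linkage E a₁ a₂ b₁ b₂ ⊎ Separation E a₁ a₂ b₁ b₂
  -- Without edges every walk is trivial. A coincidence within a pair is itself the cut; a source
  -- that is no sink separates, with the other source as cut; otherwise the two pairs agree as sets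
  -- and are linked.
  menger [] a₁ a₂ b₁ b₂
    with a₁ ≟ a₂ | b₁ ≟ b₂ | a₁ ≟ b₁ | a₁ ≟ b₂ | a₂ ≟ b₁ | a₂ ≟ b₂
  ... | yes ≡.refl | _ | _ | _ | _ | _ = inj₂ record
    { cut = a₁ ; Near = ∅ ; near? = ∅? ; closed = λ ()
    ; start₁ = inj₂ ≡.refl ; start₂ = inj₂ ≡.refl ; end₁ = λ () ; end₂ = λ () }
  ... | no _ | yes ≡.refl | _ | _ | _ | _ = inj₂ record
    { cut = b₁ ; Near = _≢ b₁ ; near? = λ v → ¬? (v ≟ b₁) ; closed = λ ()
    ; start₁ = near⁺ a₁ ; start₂ = near⁺ a₂ ; end₁ = λ b≢b → b≢b ≡.refl ; end₂ = λ b≢b → b≢b ≡.refl }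
    where
    near⁺ : ∀ v → v ≢ b₁ ⊎ v ≡ b₁
    near⁺ v with v ≟ b₁
    ... | yes eq = inj₂ eq
    ... | no neq = inj₁ neq
  ... | no a₁≢a₂ | no b₁≢b₂ | yes ≡.refl | _ | _ | yes ≡.refl =
    inj₁ (inj₁ (ε , ε , λ { (here ≡.refl , here eq) → a₁≢a₂ eq }))
  ... | no a₁≢a₂ | no b₁≢b₂ | _ | yes ≡.refl | yes ≡.refl | _ =
    inj₁ (inj₂ (ε , ε , λ { (here ≡.refl , here eq) → b₁≢b₂ eq }))
  ... | no a₁≢a₂ | no b₁≢b₂ | no a₁≢b₁ | no a₁≢b₂ | _ | _ = inj₂ record
    { cut = a₂ ; Near = _≡ a₁ ; near? = _≟ a₁ ; closed = λ ()
    ; start₁ = inj₁ ≡.refl ; start₂ = inj₂ ≡.refl ; end₁ = a₁≢b₁ ∘ ≡.sym ; end₂ = a₁≢b₂ ∘ ≡.sym }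
  ... | no a₁≢a₂ | no b₁≢b₂ | _ | _ | no a₂≢b₁ | no a₂≢b₂ = inj₂ record
    { cut = a₁ ; Near = _≡ a₂ ; near? = _≟ a₂ ; closed = λ ()
    ; start₁ = inj₂ ≡.refl ; start₂ = inj₁ ≡.refl ; end₁ = a₂≢b₁ ∘ ≡.sym ; end₂ = a₂≢b₂ ∘ ≡.sym }
  ... | no a₁≢a₂ | no b₁≢b₂ | yes ≡.refl | _ | yes ≡.refl | _ = contradiction ≡.refl a₁≢a₂
  ... | no a₁≢a₂ | no b₁≢b₂ | _ | yes ≡.refl | _ | yes ≡.refl = contradiction ≡.refl a₁≢a₂
  menger ((x , y) ∷ E) a₁ a₂ b₁ b₂ with menger E a₁ a₂ b₁ b₂
  ... | inj₁ linkage = inj₁ (Sum.map weakenWalks weakenWalks linkage)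
  ... | inj₂ S with near? S x ×-dec ¬? (near? S y) ×-dec ¬? (y ≟ cut S)
    where open Separation
  ...   | no ¬crosses = inj₂ record
    { cut = cut ; Near = Near ; near? = near? ; closed = closed′
    ; start₁ = start₁ ; start₂ = start₂ ; end₁ = end₁ ; end₂ = end₂ }
    where
    open Separation S

    closed′ : ∀ {u v} → (u , v) ∈ (x , y) ∷ E → Near u → Near⁺ v
    closed′ (there e)          nu = closed e nu
    closed′ {v = v} (here ≡.refl) nu with near? v | v ≟ cut
    ... | yes nv | _      = inj₁ nv
    ... | no _   | yes eq = inj₂ eq
    ... | no fv  | no neq = contradiction (nu , fv , neq) ¬crosses
  ...   | yes (nx , fy , y≢cut) with menger E a₁ a₂ (cut S) x | menger E (cut S) y b₁ b₂
    where open Separation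
  ...     | inj₁ P | inj₁ Q = inj₁ (glue P Q)
    where
    open Separation S

    glue : Linkage E a₁ a₂ cut x → Linkage E cut y b₁ b₂ → Linkage ((x , y) ∷ E) a₁ a₂ b₁ b₂
    glue (inj₁ P) (inj₁ Q) = inj₁ (join S start₁ start₂ end₁ end₂ P Q)
    glue (inj₁ P) (inj₂ Q) = inj₂ (swapWalks (join S start₁ start₂ end₂ end₁ P (swapWalks Q)))
    glue (inj₂ P) (inj₁ Q) = inj₂ (join S start₂ start₁ end₁ end₂ P Q)
    glue (inj₂ P) (inj₂ Q) = inj₁ (swapWalks (join S start₂ start₁ end₂ end₁ P (swapWalks Q)))
  -- Intersecting works because `S′` keeps both sinks `cut` and `x` out of `Near′`: the new edge no
  -- longer starts in the near set, and an edge of `E` that leaves `Near` through the old cut must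
  -- hit `cut′`.
  ...     | inj₂ S′ | _ = inj₂ record
    { cut = cut′ ; Near = Near ∩ Near′ ; near? = near? ∩? near?′ ; closed = closed″
    ; start₁ = near⁺ start₁ start₁′ ; start₂ = near⁺ start₂ start₂′
    ; end₁ = end₁ ∘ proj₁ ; end₂ = end₂ ∘ proj₁ }
    where
    open Separation S
    open Separation S′ using () renaming
      (cut to cut′; Near to Near′; near? to near?′; Near⁺ to Near⁺′; closed to closed′
      ; start₁ to start₁′; start₂ to start₂′; end₁ to end₁′; end₂ to end₂′)

    near⁺ : ∀ {v} → Near⁺ v → Near⁺′ v → Near v × Near′ v ⊎ v ≡ cut′
    near⁺ (inj₁ nv)   (inj₁ nv′) = inj₁ (nv , nv′)
    near⁺ (inj₂ ≡.refl) (inj₁ nv′) = contradiction nv′ end₁′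
    near⁺ _           (inj₂ eq)  = inj₂ eq

    closed″ : ∀ {u v} → (u , v) ∈ (x , y) ∷ E → Near u × Near′ u → Near v × Near′ v ⊎ v ≡ cut′
    closed″ (here ≡.refl) (_ , nx′)  = contradiction nx′ end₂′
    closed″ (there e)   (nu , nu′) = near⁺ (closed e nu) (closed′ e nu′)
  -- Dually for the union: the old exits from `Near` are `cut` and now `y`, and both are sources of
  -- `S′`, hence in `Near′` or equal to `cut′`.
  ...     | inj₁ _ | inj₂ S′ = inj₂ record
    { cut = cut′ ; Near = Near ∪ Near′ ; near? = near? ∪? near?′ ; closed = closed″
    ; start₁ = near⁺ start₁ ; start₂ = near⁺ start₂
    ; end₁ = [ end₁ , end₁′ ]′ ; end₂ = [ end₂ , end₂′ ]′ }
    where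
    open Separation S
    open Separation S′ using () renaming
      (cut to cut′; Near to Near′; near? to near?′; Near⁺ to Near⁺′; closed to closed′
      ; start₁ to start₁′; start₂ to start₂′; end₁ to end₁′; end₂ to end₂′)

    near⁺′ : ∀ {v} → Near⁺′ v → (Near v ⊎ Near′ v) ⊎ v ≡ cut′
    near⁺′ = Sum.map₁ inj₂

    near⁺ : ∀ {v} → Near⁺ v → (Near v ⊎ Near′ v) ⊎ v ≡ cut′
    near⁺ (inj₁ nv)   = inj₁ (inj₁ nv)
    near⁺ (inj₂ ≡.refl) = near⁺′ start₁′

    closed″ : ∀ {u v} → (u , v) ∈ (x , y) ∷ E → Near u ⊎ Near′ u → (Near v ⊎ Near′ v) ⊎ v ≡ cut′
    closed″ (here ≡.refl) _          = near⁺′ start₂′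
    closed″ (there e)   (inj₁ nu)  = near⁺ (closed e nu)
    closed″ (there e)   (inj₂ nu′) = near⁺′ (closed′ e nu′)

-- Matrices acting on vectors

module MatrixProperties (R : CommutativeRing c ℓ) where
  open CommutativeRing R hiding (zero)
  open Matrices R
  open SemiringSum semiring
  open SetoidReasoning setoid

  KernelFree : ∀ {m n} → Matrix m n → Set _
  KernelFree M = ∀ v → (∀ i → (M *ᵛ v) i ≈ 0#) → ∀ j → v j ≈ 0#

  identity-≡ : ∀ {n} {i j : Fin n} → i ≡ j → identity i j ≈ 1#
  identity-≡ {i = i} {j} eq with i ≟ j
  ... | yes _  = refl
  ... | no neq = contradiction eq neq

  identity-≢ : ∀ {n} {i j : Fin n} → i ≢ j → identity i j ≈ 0#
  identity-≢ {i = i} {j} neq with i ≟ j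
  ... | yes eq = contradiction eq neq
  ... | no _   = refl

  sum-zero : ∀ {n} (f : Vector Carrier n) → (∀ i → f i ≈ 0#) → sum f ≈ 0#
  sum-zero {n} f f≈0 = trans (sum-cong-≋ f≈0) (sum-replicate-zero n)

  sum-single : ∀ {n} (f : Vector Carrier n) j → (∀ {i} → i ≢ j → f i ≈ 0#) → sum f ≈ f j
  sum-single f zero f≈0 =
    trans (+-congˡ (sum-zero (f ∘ suc) (λ i → f≈0 λ ()))) (+-identityʳ _)
  sum-single f (suc j) f≈0 =
    trans (+-cong (f≈0 λ ()) (sum-single (f ∘ suc) j (λ i≢j → f≈0 (i≢j ∘ suc-injective)))) (+-identityˡ _)

  identity-sumˡ : ∀ {n} (v : Vector Carrier n) i → sum (λ j → identity i j * v j) ≈ v i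
  identity-sumˡ v i =
    trans (sum-single _ i λ j≢i → trans (*-congʳ (identity-≢ (j≢i ∘ ≡.sym))) (zeroˡ _))
          (trans (*-congʳ (identity-≡ {i = i} ≡.refl)) (*-identityˡ _))

  identity-sumʳ : ∀ {n} (v : Vector Carrier n) i → sum (λ j → identity j i * v j) ≈ v i
  identity-sumʳ v i =
    trans (sum-single _ i λ j≢i → trans (*-congʳ (identity-≢ j≢i)) (zeroˡ _))
          (trans (*-congʳ (identity-≡ {i = i} ≡.refl)) (*-identityˡ _))

  *ᵛ-identity : ∀ {m n} (M : Matrix m n) i j → (M *ᵛ identity j) i ≈ M i j
  *ᵛ-identity {n = n} M i j = trans (sum-cong-≋ {n} λ k → *-comm _ _) (identity-sumˡ (M i) j)

  *ᵛ-cong : ∀ {m n} {M N : Matrix m n} {v w} → M ≈ᴹ N → (∀ j → v j ≈ w j) → ∀ i → (M *ᵛ v) i ≈ (N *ᵛ w) i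
  *ᵛ-cong {n = n} M≈N v≈w i = sum-cong-≋ {n} λ j → *-cong (M≈N i j) (v≈w j)

  *ᵛ-zero : ∀ {m n} (M : Matrix m n) v → (∀ j → v j ≈ 0#) → ∀ i → (M *ᵛ v) i ≈ 0#
  *ᵛ-zero M v v≈0 i = sum-zero _ λ j → trans (*-congˡ (v≈0 j)) (zeroʳ _)

  *ᵛ-assoc : ∀ {m n p} (M : Matrix m n) (N : Matrix n p) v i → ((M *ᴹ N) *ᵛ v) i ≈ (M *ᵛ (N *ᵛ v)) i
  *ᵛ-assoc {m} {n} {p} M N v i = begin
    sum (λ l → sum (λ k → M i k * N k l) * v l)    ≈⟨ sum-cong-≋ {p} (λ l → *-distribʳ-sum {n} (v l) (λ k → M i k * N k l)) ⟩
    sum (λ l → sum (λ k → M i k * N k l * v l))    ≈⟨ ∑-comm {p} {n} _ ⟩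
    sum (λ k → sum (λ l → M i k * N k l * v l))    ≈⟨ sum-cong-≋ {n} (λ k → sum-cong-≋ {p} λ l → *-assoc _ _ _) ⟩
    sum (λ k → sum (λ l → M i k * (N k l * v l)))  ≈⟨ sum-cong-≋ {n} (λ k → *-distribˡ-sum {p} (M i k) (λ l → N k l * v l)) ⟨
    sum (λ k → M i k * sum (λ l → N k l * v l))    ∎

  *ᵛ-distribˡ : ∀ {m n} (M : Matrix m n) v w i → (M *ᵛ (λ j → v j + w j)) i ≈ (M *ᵛ v) i + (M *ᵛ w) i
  *ᵛ-distribˡ {n = n} M v w i = trans (sum-cong-≋ {n} λ j → distribˡ _ _ _) (∑-distrib-+ {n} _ _)

  *ᵛ-scale : ∀ {m n} (M : Matrix m n) a v i → (M *ᵛ (λ j → v j * a)) i ≈ (M *ᵛ v) i * a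
  *ᵛ-scale {n = n} M a v i = trans (sum-cong-≋ {n} λ j → sym (*-assoc _ _ _)) (sym (*-distribʳ-sum {n} a λ j → M i j * v j))

  leftInverse⇒kernelFree : ∀ {n} {M N : Matrix n n} → N *ᴹ M ≈ᴹ identity → KernelFree M
  leftInverse⇒kernelFree {M = M} {N} NM≈I v Mv≈0 j = begin
    v j                    ≈⟨ identity-sumˡ v j ⟨
    (identity *ᵛ v) j      ≈⟨ *ᵛ-cong NM≈I (λ _ → refl) j ⟨
    ((N *ᴹ M) *ᵛ v) j      ≈⟨ *ᵛ-assoc N M v j ⟩
    (N *ᵛ (M *ᵛ v)) j      ≈⟨ *ᵛ-zero N _ Mv≈0 j ⟩
    0#                     ∎

-- Dependence of m + 1 vectors in dimension m over a Heyting field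

module WideMatrices (K : HeytingField c ℓ ℓ′) where
  open HeytingField K hiding (zero)
  open HeytingProperties heytingCommutativeRing using (1#0; x-0≈x)
  open RingProperties (CommutativeRing.ring (ringOf K)) using (-‿distribʳ-*)
  open Matrices (ringOf K)
  open MatrixProperties (ringOf K)
  open SemiringSum (CommutativeRing.semiring (ringOf K))
  open SemiringSolver (CommutativeRing.commutativeSemiring (ringOf K)) using (solve; _:+_; _:*_; _:=_; con)
  open SetoidReasoning (CommutativeRing.setoid (ringOf K))

  -- With -1/a in place of 1/a, elimination uses sums and products only and stays within reach of
  -- the semiring solver.
  negatedInverse : ∀ {a} → a # 0# → ∃[ b ] a * b + 1# ≈ 0#
  negatedInverse {a} a#0 with #⇒invertible a#0
  ... | w , _ , a-0*w≈1 = - w , (begin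
    a * - w + 1#                 ≈⟨ +-cong (-‿distribʳ-* a w) (trans (*-congʳ (sym (x-0≈x a))) a-0*w≈1) ⟨
    - (a * w) + a * w            ≈⟨ -‿inverseˡ _ ⟩
    0#                           ∎)

  -- Gaussian elimination without deciding whether an entry vanishes. A first-row entry apart from 0
  -- would be a pivot, and eliminating it gives a smaller wide matrix that is again kernel-free,
  -- which is impossible by induction. So no first-row entry is apart from 0, the whole row vanishes
  -- by tightness, and dropping it together with the first column reaches the same contradiction.
  wide⇒¬kernelFree : ∀ m (M : Matrix m (suc m)) → ¬ KernelFree M
  wide⇒¬kernelFree zero    M free = #-irrefl (free (λ _ → 1#) (λ ()) zero) 1#0
  wide⇒¬kernelFree (suc m) M free = wide⇒¬kernelFree m (λ i → M (suc i) ∘ suc) λ v Mv≈0 l →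
    free (0# Vector.∷ v) (λ { zero    → sum-zero (λ j → M zero j * (0# Vector.∷ v) j) (λ j → trans (*-congʳ (row₀ j)) (zeroˡ _))
                            ; (suc i) → trans (+-cong (zeroʳ _) (Mv≈0 i)) (+-identityˡ _) }) (suc l)
    where
    no-pivot : ∀ j → ¬ (M zero j # 0#)
    no-pivot j a#0 with negatedInverse a#0
    ... | b , ab+1≈0 = wide⇒¬kernelFree m eliminated λ v Mv≈0 l →
      trans (sym (reflexive (insertAt-punchIn v j (b * rest zero v) l))) (free (extend v) (kernel v Mv≈0) (punchIn j l))
      where
      eliminated : Matrix m (suc m)
      eliminated i l = M (suc i) (punchIn j l) + M (suc i) j * b * M zero (punchIn j l)

      rest : Fin (suc m) → Vector Carrier (suc m) → Carrier
      rest i v = sum λ l → M i (punchIn j l) * v l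

      extend : Vector Carrier (suc m) → Vector Carrier (suc (suc m))
      -- The inserted coordinate is the one that solves row `zero` for the pivot variable, since `b`
      -- is -1 over the pivot.
      extend v = Vector.insertAt v j (b * rest zero v)

      expand : ∀ i v → (M *ᵛ extend v) i ≈ M i j * (b * rest zero v) + rest i v
      expand i v = trans (sum-remove {i = j} (λ l → M i l * extend v l)) (+-cong
        (*-congˡ (reflexive (insertAt-lookup v j (b * rest zero v))))
        (sum-cong-≋ {suc m} λ l → *-congˡ {x = M i (punchIn j l)} (reflexive (insertAt-punchIn v j (b * rest zero v) l))))

      eliminate : ∀ i v → (eliminated *ᵛ v) i ≈ rest (suc i) v + M (suc i) j * b * rest zero v
      eliminate i v = begin
        sum (λ l → (M (suc i) (punchIn j l) + M (suc i) j * b * M zero (punchIn j l)) * v l)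
          ≈⟨ sum-cong-≋ {suc m} (λ l → trans (distribʳ (v l) (M (suc i) (punchIn j l)) (M (suc i) j * b * M zero (punchIn j l)))
                                   (+-congˡ (*-assoc (M (suc i) j * b) (M zero (punchIn j l)) (v l)))) ⟩
        sum (λ l → M (suc i) (punchIn j l) * v l + M (suc i) j * b * (M zero (punchIn j l) * v l))
          ≈⟨ ∑-distrib-+ {suc m} (λ l → M (suc i) (punchIn j l) * v l)
                                  (λ l → M (suc i) j * b * (M zero (punchIn j l) * v l)) ⟩
        rest (suc i) v + sum (λ l → M (suc i) j * b * (M zero (punchIn j l) * v l))
          ≈⟨ +-congˡ (*-distribˡ-sum {suc m} (M (suc i) j * b) (λ l → M zero (punchIn j l) * v l)) ⟨
        rest (suc i) v + M (suc i) j * b * rest zero v ∎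

      kernel : ∀ v → (∀ i → (eliminated *ᵛ v) i ≈ 0#) → ∀ i → (M *ᵛ extend v) i ≈ 0#
      kernel v Mv≈0 zero = begin
        (M *ᵛ extend v) zero                          ≈⟨ expand zero v ⟩
        M zero j * (b * rest zero v) + rest zero v    ≈⟨ solve 3 (λ a b r → a :* (b :* r) :+ r := (a :* b :+ con 1) :* r) refl (M zero j) b (rest zero v) ⟩
        (M zero j * b + 1#) * rest zero v             ≈⟨ *-congʳ ab+1≈0 ⟩
        0# * rest zero v                              ≈⟨ zeroˡ _ ⟩
        0#                                            ∎
      kernel v Mv≈0 (suc i) = begin
        (M *ᵛ extend v) (suc i)                                  ≈⟨ expand (suc i) v ⟩
        M (suc i) j * (b * rest zero v) + rest (suc i) v         ≈⟨ +-comm _ _ ⟩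
        rest (suc i) v + M (suc i) j * (b * rest zero v)         ≈⟨ +-congˡ (*-assoc _ _ _) ⟨
        rest (suc i) v + M (suc i) j * b * rest zero v           ≈⟨ eliminate i v ⟨
        (eliminated *ᵛ v) i                                      ≈⟨ Mv≈0 i ⟩
        0#                                                       ∎

    row₀ : ∀ j → M zero j ≈ 0#
    row₀ j = proj₁ (tight _ _) (no-pivot j)

-- Embedding a domain in its fraction field

module Fractions (R : CommutativeRing c ℓ) {NonZero : CommutativeRing.Carrier R → Set ℓ′}
                 (dom : IsApartDomain R NonZero) where
  private
    module R = CommutativeRing R
    Q = fractionField R dom
  open HeytingField Q using (_≈_; _+_; _*_; _#_; 0#; 1#)
  private module Q = CommutativeRing (ringOf Q)
  open IsApartDomain dom
  open RingProperties R.ring using (-0#≈0#)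
  open SemiringSolver R.commutativeSemiring

  embed : R.Carrier → HeytingField.Carrier Q
  embed a = fraction a R.1# nz-1

  embed-cong : ∀ {a b} → a R.≈ b → embed a ≈ embed b
  embed-cong = R.*-congʳ

  embed-injective : ∀ {a b} → embed a ≈ embed b → a R.≈ b
  embed-injective eq = R.trans (R.sym (R.*-identityʳ _)) (R.trans eq (R.*-identityʳ _))

  embed-+ : ∀ a b → embed (a R.+ b) ≈ embed a + embed b
  embed-+ = solve 2 (λ a b → (a :+ b) :* (con 1 :* con 1) := (a :* con 1 :+ b :* con 1) :* con 1) R.refl

  embed-* : ∀ a b → embed (a R.* b) ≈ embed a * embed b
  embed-* = solve 2 (λ a b → (a :* b) :* (con 1 :* con 1) := (a :* b) :* con 1) R.refl

  embed-# : ∀ {a} → NonZero a → embed a # 0#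
  embed-# {a} = nz-cong (R.sym (R.trans
    (R.+-cong (R.*-identityʳ a) (R.trans (R.*-identityʳ _) -0#≈0#))
    (R.+-identityʳ a)))

  den-* : ∀ w → embed (Fraction.den w) * w ≈ embed (Fraction.num w)
  den-* (fraction a b _) = solve 2 (λ a b → (b :* a) :* con 1 := a :* (con 1 :* b)) R.refl a b

  commonDenominator : ∀ {m} (w : Fin m → HeytingField.Carrier Q) →
                      Σ R.Carrier λ d → Σ (Fin m → R.Carrier) λ r →
                      NonZero d × (∀ i → embed d * w i ≈ embed (r i))
  commonDenominator {zero}  w = R.1# , (λ ()) , nz-1 , λ ()
  commonDenominator {suc m} w with commonDenominator (w ∘ suc)
  ... | d , r , nz , eq = den R.* d , numerators , nz-* (Fraction.den-nz (w zero)) nz , cleared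
    where
    den = Fraction.den (w zero)

    numerators : Fin (suc m) → R.Carrier
    numerators zero    = d R.* Fraction.num (w zero)
    numerators (suc i) = den R.* r i

    cleared : ∀ i → embed (den R.* d) * w i ≈ embed (numerators i)
    cleared zero = begin
      embed (den R.* d) * w zero          ≈⟨ Q.*-congʳ {w zero} {embed (den R.* d)} {embed (d R.* den)} (embed-cong (R.*-comm den d)) ⟩
      embed (d R.* den) * w zero          ≈⟨ Q.*-congʳ {w zero} {embed (d R.* den)} {embed d * embed den} (embed-* d den) ⟩
      embed d * embed den * w zero        ≈⟨ Q.*-assoc (embed d) (embed den) (w zero) ⟩
      embed d * (embed den * w zero)      ≈⟨ Q.*-congˡ {embed d} {embed den * w zero} {embed (Fraction.num (w zero))} (den-* (w zero)) ⟩
      embed d * embed (Fraction.num (w zero))      ≈⟨ embed-* d _ ⟨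
      embed (numerators zero)             ∎
      where open SetoidReasoning Q.setoid
    cleared (suc i) = begin
      embed (den R.* d) * w (suc i)          ≈⟨ Q.*-congʳ {w (suc i)} {embed (den R.* d)} {embed den * embed d} (embed-* den d) ⟩
      embed den * embed d * w (suc i)        ≈⟨ Q.*-assoc (embed den) (embed d) (w (suc i)) ⟩
      embed den * (embed d * w (suc i))      ≈⟨ Q.*-congˡ {embed den} {embed d * w (suc i)} {embed (r i)} (eq i) ⟩
      embed den * embed (r i)                ≈⟨ embed-* den (r i) ⟨
      embed (numerators (suc i))             ∎
      where open SetoidReasoning Q.setoid

-- The node equations as additive flows

module _ {n} (D : SignalFlowGraph n) where
  open SignalFlowGraph D

  -- The node equations in a commutative monoid, so that they can be moved
  -- along additive maps.
  module _ (M : CommutativeMonoid c ℓ) where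
    open CommutativeMonoid M renaming (_∙_ to _+_; ε to 0#)

    branchSignal : (Fin n → Carrier) → (Node → Carrier) → Branch → Carrier
    branchSignal x val (inj₁ i) = x i
    branchSignal x val (inj₂ j) = val (source (inj₂ j))

    total : ∀ {A : Set} → (A → Carrier) → List A → Carrier
    total f es = foldr _+_ 0# (map f es)

    record Flow (x : Fin n → Carrier) (u : Fin 2 → Carrier) (val : Node → Carrier) : Set ℓ where
      field
        at-input : ∀ k → val (input k) ≈ u k
        at-inner : ∀ v → (∀ k → v ≢ input k) → val v ≈ total (branchSignal x val) (entering v)

  module _ (M : CommutativeMonoid c ℓ) where
    open CommutativeMonoid M renaming (_∙_ to _+_; ε to 0#; ∙-cong to +-cong; ∙-congˡ to +-congˡ)
    open CommutativeSemigroupProperties commutativeSemigroup using (interchange)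
    open MonoidSum monoid using (sum)
    open Flow

    total-cong : ∀ {A : Set} {f g : A → Carrier} → (∀ a → f a ≈ g a) → ∀ es → total M f es ≈ total M g es
    total-cong f≈g []       = refl
    total-cong f≈g (e ∷ es) = +-cong (f≈g e) (total-cong f≈g es)

    total-0 : ∀ {A : Set} (es : List A) → total M (λ _ → 0#) es ≈ 0#
    total-0 []       = refl
    total-0 (_ ∷ es) = trans (identityˡ _) (total-0 es)

    total-+ : ∀ {A : Set} (f g : A → Carrier) es → total M (λ a → f a + g a) es ≈ total M f es + total M g es
    total-+ f g []       = sym (identityˡ 0#)
    total-+ f g (e ∷ es) = trans (+-congˡ (total-+ f g es)) (interchange _ _ _ _)

    flow-cong : ∀ {x x′ u u′ val val′} → (∀ i → x i ≈ x′ i) → (∀ k → u k ≈ u′ k) → (∀ v → val v ≈ val′ v) →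
                Flow M x u val → Flow M x′ u′ val′
    flow-cong x≈ u≈ val≈ F .at-input k = trans (sym (val≈ _)) (trans (at-input F k) (u≈ k))
    flow-cong x≈ u≈ val≈ F .at-inner v v≢ = trans (sym (val≈ v)) (trans (at-inner F v v≢)
      (total-cong (λ { (inj₁ i) → x≈ i ; (inj₂ j) → val≈ _ }) (entering v)))

    flow-+ : ∀ {x x′ u u′ val val′} → Flow M x u val → Flow M x′ u′ val′ →
             Flow M (λ i → x i + x′ i) (λ k → u k + u′ k) (λ v → val v + val′ v)
    flow-+ F G .at-input k = +-cong (at-input F k) (at-input G k)
    flow-+ F G .at-inner v v≢ = trans (+-cong (at-inner F v v≢) (at-inner G v v≢))
      (trans (sym (total-+ _ _ (entering v)))
             (total-cong (λ { (inj₁ i) → refl ; (inj₂ j) → refl }) (entering v)))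

    flow-0 : Flow M (λ _ → 0#) (λ _ → 0#) (λ _ → 0#)
    flow-0 .at-input k = refl
    flow-0 .at-inner v _ = sym (trans (total-cong (λ { (inj₁ i) → refl ; (inj₂ j) → refl }) (entering v))
                                      (total-0 (entering v)))

    flow-sum : ∀ {m} {x : Fin m → _} {u : Fin m → _} {val : Fin m → _} → (∀ a → Flow M (x a) (u a) (val a)) →
               Flow M (λ i → sum (λ a → x a i)) (λ k → sum (λ a → u a k)) (λ v → sum (λ a → val a v))
    flow-sum {zero}  F = flow-0
    flow-sum {suc m} F = flow-+ (F zero) (flow-sum (F ∘ suc))

  module _ (M₁ : CommutativeMonoid c₁ ℓ₁) (M₂ : CommutativeMonoid c₂ ℓ₂) where
    private
      module M₁ = CommutativeMonoid M₁
      module M₂ = CommutativeMonoid M₂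
    open MonoidMorphisms M₁.rawMonoid M₂.rawMonoid
    open Flow

    module _ {f : M₁.Carrier → M₂.Carrier} (hom : IsMonoidHomomorphism f) where
      open IsMonoidHomomorphism hom

      total-homo : ∀ {A : Set} (g : A → M₁.Carrier) es → f (total M₁ g es) M₂.≈ total M₂ (f ∘ g) es
      total-homo g []       = ε-homo
      total-homo g (e ∷ es) = M₂.trans (homo _ _) (M₂.∙-congˡ (total-homo g es))

      total-branchSignal : ∀ x val es → f (total M₁ (branchSignal M₁ x val) es) M₂.≈
                           total M₂ (branchSignal M₂ (f ∘ x) (f ∘ val)) es
      total-branchSignal x val es = M₂.trans (total-homo _ es)
        (total-cong M₂ (λ { (inj₁ i) → M₂.refl ; (inj₂ j) → M₂.refl }) es)

      flow-map : ∀ {x u val} → Flow M₁ x u val → Flow M₂ (f ∘ x) (f ∘ u) (f ∘ val)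
      flow-map F .at-input k = ⟦⟧-cong (at-input F k)
      flow-map {x} {u} {val} F .at-inner v v≢ =
        M₂.trans (⟦⟧-cong (at-inner F v v≢)) (total-branchSignal x val (entering v))

      flow-reflect : (∀ {a b} → f a M₂.≈ f b → a M₁.≈ b) → ∀ {x u val} →
                     Flow M₂ (f ∘ x) (f ∘ u) (f ∘ val) → Flow M₁ x u val
      flow-reflect inj F .at-input k = inj (at-input F k)
      flow-reflect inj {x} {u} {val} F .at-inner v v≢ =
        inj (M₂.trans (at-inner F v v≢) (M₂.sym (total-branchSignal x val (entering v))))

-- Branches entering a node

module _ {n} (D : SignalFlowGraph n) where
  open SignalFlowGraph D

  ∈-branches : ∀ e → e ∈ branches
  ∈-branches (inj₁ i) = ∈-++⁺ˡ (∈-map⁺ inj₁ (∈-allFin i))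
  ∈-branches (inj₂ j) = ∈-++⁺ʳ (map inj₁ (allFin n)) (∈-map⁺ inj₂ (∈-allFin j))

  entering-target : ∀ {v e} → e ∈ entering v → target e ≡ v
  entering-target e∈ = proj₂ (∈-filter⁻ (λ e → target e ≟ _) {xs = branches} e∈)

  ∈-entering : ∀ e → e ∈ entering (target e)
  ∈-entering e = ∈-filter⁺ (λ e′ → target e′ ≟ target e) (∈-branches e) ≡.refl

  entering-input : ∀ k → entering (input k) ≡ []
  entering-input k with entering (input k) | input-inDegree k
  ... | [] | _ = ≡.refl

  entering-first : ∀ i → entering (target (inj₁ i)) ≡ inj₁ i ∷ []
  entering-first i with entering (target (inj₁ i)) | proj₁ (series i) | ∈-entering (inj₁ i)
  ... | _ ∷ [] | _ | here ≡.refl = ≡.refl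

  data Entering (v : Node) : Set where
    first-order : ∀ i → target (inj₁ i) ≡ v → Entering v
    zero-order  : (∀ i → inj₁ i ∉ entering v) → Entering v

  classify : ∀ v → Entering v
  classify v with any? (λ i → target (inj₁ i) ≟ v)
  ... | yes (i , eq) = first-order i eq
  ... | no none      = zero-order λ i i∈ → none (i , entering-target i∈)

-- P and Q send the states and the inputs to the node values; p stands for s - z
-- and S for sI - A.
record Response (L : CommutativeRing c ℓ) {n} (D : SignalFlowGraph n) : Set (c ⊔ ℓ) where
  open CommutativeRing L
  open SignalFlowGraph D
  open Matrices L
  private +M = +-commutativeMonoid
  field
    p     : Fin n → Carrier
    S N   : Matrix n n
    B     : Matrix n 2
    C     : Matrix 2 n
    P     : Node → Fin n → Carrier
    Q     : Node → Fin 2 → Carrier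
    NS≈I  : N *ᴹ S ≈ᴹ identity
    SN≈I  : S *ᴹ N ≈ᴹ identity
    flow-P : ∀ i → Flow D +M (identity i) (λ _ → 0#) (λ v → P v i)
    flow-Q : ∀ k → Flow D +M (λ _ → 0#) (identity k) (λ v → Q v k)
    unique : ∀ w → Flow D +M (λ _ → 0#) (λ _ → 0#) w → ∀ v → w v ≈ 0#
    state-P : ∀ i j → S i j + P (source (inj₁ i)) j ≈ p i * identity i j
    state-Q : ∀ i k → Q (source (inj₁ i)) k ≈ B i k
    output-P : ∀ k i → P (output k) i ≈ C k i
    output-Q : ∀ k j → Q (output k) j ≈ 0#

-- The square system of the nodes and its solutions

module ResponseProperties {L : CommutativeRing c ℓ} {n} {D : SignalFlowGraph n} (response : Response L D) where
  open CommutativeRing L hiding (zero)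
  open SignalFlowGraph D
  open Response response
  open Matrices L
  open MatrixProperties L
  open RingProperties ring using (+-cancelʳ; +-identityˡ-unique; -‿+-comm; -0#≈0#; x∙y⁻¹≈ε⇒x≈y)
  open SemiringSum semiring
  open SetoidReasoning setoid
  open Flow
  private +M = +-commutativeMonoid

  respond : Vector Carrier n → Vector Carrier 2 → Node → Carrier
  respond x u v = (P *ᵛ x) v + (Q *ᵛ u) v

  flow-scale : ∀ a {x u val} → Flow D +M x u val → Flow D +M (λ i → x i * a) (λ k → u k * a) (λ v → val v * a)
  flow-scale a = flow-map D +M +M record
    { isMagmaHomomorphism = record
      { isRelHomomorphism = record { cong = *-congʳ }
      ; homo = distribʳ a }
    ; ε-homo = zeroˡ a }

  flow-neg : ∀ {x u val} → Flow D +M x u val → Flow D +M (λ i → - x i) (λ k → - u k) (λ v → - val v)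
  flow-neg = flow-map D +M +M record
    { isMagmaHomomorphism = record
      { isRelHomomorphism = record { cong = -‿cong }
      ; homo = λ a b → sym (-‿+-comm a b) }
    ; ε-homo = -0#≈0# }

  flow-respond : ∀ x u → Flow D +M x u (respond x u)
  flow-respond x u = flow-cong D +M
    (λ i → trans (+-cong (identity-sumʳ x i) (sum-zero (λ k → 0# * u k) λ k → zeroˡ _)) (+-identityʳ _))
    (λ k → trans (+-cong (sum-zero (λ i → 0# * x i) λ i → zeroˡ _) (identity-sumʳ u k)) (+-identityˡ _))
    (λ v → refl)
    (flow-+ D +M (flow-sum D +M λ i → flow-scale (x i) (flow-P i))
                 (flow-sum D +M λ k → flow-scale (u k) (flow-Q k)))

  -- The difference of two flows with equal data is a flow with zero data, which `unique`
  -- annihilates.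
  respond-unique : ∀ {x u val} → Flow D +M x u val → ∀ v → val v ≈ respond x u v
  respond-unique {x} {u} {val} F v = x∙y⁻¹≈ε⇒x≈y (val v) (respond x u v) (unique _
    (flow-cong D +M (λ i → -‿inverseʳ _) (λ k → -‿inverseʳ _) (λ _ → refl)
      (flow-+ D +M F (flow-neg (flow-respond x u)))) v)

  -- `state-P` says that `S` is diag(p) minus `P` at the sources of the first-order branches. So
  -- without input, `S x = 0` is the transformed state equation (s - zᵢ) xᵢ = w.
  state-*ᵛ : ∀ x i → (S *ᵛ x) i + (P *ᵛ x) (source (inj₁ i)) ≈ p i * x i
  state-*ᵛ x i = begin
    (S *ᵛ x) i + (P *ᵛ x) (source (inj₁ i))
      ≈⟨ ∑-distrib-+ {n} (λ j → S i j * x j) (λ j → P (source (inj₁ i)) j * x j) ⟨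
    sum (λ j → S i j * x j + P (source (inj₁ i)) j * x j)
      ≈⟨ sum-cong-≋ {n} (λ j → trans (sym (distribʳ (x j) _ _)) (trans (*-congʳ (state-P i j)) (*-assoc _ _ _))) ⟩
    sum (λ j → p i * (identity i j * x j))
      ≈⟨ *-distribˡ-sum {n} (p i) (λ j → identity i j * x j) ⟨
    p i * sum (λ j → identity i j * x j)
      ≈⟨ *-congˡ (identity-sumˡ x i) ⟩
    p i * x i ∎

  -- Inspecting the head suffices: a first-order branch that enters a node is the only one to do so.
  -- The default 1 also covers the inputs, which no branch enters.
  divisor : List Branch → Carrier
  divisor (inj₁ i ∷ _) = p i
  divisor _            = 1#

  divisor-zero-order : ∀ es → (∀ i → inj₁ i ∉ es) → divisor es ≈ 1#
  divisor-zero-order []            none = refl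
  divisor-zero-order (inj₁ i ∷ _) none = contradiction (here ≡.refl) (none i)
  divisor-zero-order (inj₂ j ∷ _) none = refl

  -- Node v carries the equation divisor v * val v ≈ ∑ val w, the sum running
  -- over the branches w → v: a first-order branch is the only one into its
  -- target, so its gain 1 / (s - zᵢ) can be cleared.
  nodeMatrix : Matrix #nodes #nodes
  nodeMatrix v w = divisor (entering v) * identity v w - total D +M (λ e → identity (source e) w) (entering v)

  sources : (Node → Carrier) → Node → Carrier
  sources val v = total D +M (val ∘ source) (entering v)

  total-*ᵛ : ∀ val es → sum (λ w → total D +M (λ e → identity (source e) w) es * val w) ≈ total D +M (val ∘ source) es
  total-*ᵛ val []       = sum-zero (λ w → 0# * val w) λ w → zeroˡ _
  total-*ᵛ val (e ∷ es) = begin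
    sum (λ w → (identity (source e) w + T w) * val w)
      ≈⟨ sum-cong-≋ {#nodes} (λ w → distribʳ (val w) _ _) ⟩
    sum (λ w → identity (source e) w * val w + T w * val w)
      ≈⟨ ∑-distrib-+ {#nodes} (λ w → identity (source e) w * val w) (λ w → T w * val w) ⟩
    sum (λ w → identity (source e) w * val w) + sum (λ w → T w * val w)
      ≈⟨ +-cong (identity-sumˡ val (source e)) (total-*ᵛ val es) ⟩
    val (source e) + total D +M (val ∘ source) es ∎
    where
    T : Node → Carrier
    T w = total D +M (λ e → identity (source e) w) es

  nodeMatrix-*ᵛ : ∀ val v → (nodeMatrix *ᵛ val) v + sources val v ≈ divisor (entering v) * val v
  nodeMatrix-*ᵛ val v = begin
    (nodeMatrix *ᵛ val) v + sources val v
      ≈⟨ +-congˡ (total-*ᵛ val (entering v)) ⟨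
    (nodeMatrix *ᵛ val) v + sum (λ w → T w * val w)
      ≈⟨ ∑-distrib-+ {#nodes} (λ w → nodeMatrix v w * val w) (λ w → T w * val w) ⟨
    sum (λ w → nodeMatrix v w * val w + T w * val w)
      ≈⟨ sum-cong-≋ {#nodes} (λ w → trans (sym (distribʳ (val w) _ _)) (trans (*-congʳ (cancel w)) (*-assoc _ _ _))) ⟩
    sum (λ w → d * (identity v w * val w))
      ≈⟨ *-distribˡ-sum {#nodes} d (λ w → identity v w * val w) ⟨
    d * sum (λ w → identity v w * val w)
      ≈⟨ *-congˡ (identity-sumˡ val v) ⟩
    d * val v ∎
    where
    d = divisor (entering v)
    T : Node → Carrier
    T w = total D +M (λ e → identity (source e) w) (entering v)

    cancel : ∀ w → nodeMatrix v w + T w ≈ d * identity v w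
    cancel w = trans (+-assoc _ _ _) (trans (+-congˡ (-‿inverseˡ _)) (+-identityʳ _))

  total-zero-order : ∀ x val es → (∀ i → inj₁ i ∉ es) →
                     total D +M (branchSignal D +M x val) es ≈ total D +M (val ∘ source) es
  total-zero-order x val []            none = refl
  total-zero-order x val (inj₁ i ∷ es) none = contradiction (here ≡.refl) (none i)
  total-zero-order x val (inj₂ j ∷ es) none = +-congˡ (total-zero-order x val es (λ i → none i ∘ there))

  total-first-order : ∀ (f : Branch → Carrier) i → total D +M f (entering (target (inj₁ i))) ≈ f (inj₁ i)
  total-first-order f i rewrite entering-first D i = +-identityʳ _

  divisor-first-order : ∀ i → divisor (entering (target (inj₁ i))) ≈ p i
  divisor-first-order i rewrite entering-first D i = refl

  total-input : ∀ (f : Branch → Carrier) k → total D +M f (entering (input k)) ≈ 0#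
  total-input f k rewrite entering-input D k = refl

  divisor-input : ∀ k → divisor (entering (input k)) ≈ 1#
  divisor-input k rewrite entering-input D k = refl

  -- A kernel vector is a flow with zero input once the states are read off at the targets of the
  -- first-order branches. The rows of these targets then say `S x = 0`, so `x` vanishes because `N`
  -- inverts `S`, and a flow with zero data vanishes.
  nodeMatrix-kernelFree : KernelFree nodeMatrix
  nodeMatrix-kernelFree val Mval≈0 v = begin
    val v                           ≈⟨ respond-unique flow v ⟩
    (P *ᵛ x) v + (Q *ᵛ u₀) v        ≈⟨ +-cong (*ᵛ-zero P x x≈0 v) (*ᵛ-zero Q u₀ (λ _ → refl) v) ⟩
    0# + 0#                         ≈⟨ +-identityˡ 0# ⟩
    0#                              ∎
    where
    x : Vector Carrier n
    x i = val (target (inj₁ i))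

    u₀ : Vector Carrier 2
    u₀ _ = 0#

    balance : ∀ v → sources val v ≈ divisor (entering v) * val v
    balance v = trans (sym (+-identityˡ _)) (trans (+-congʳ (sym (Mval≈0 v))) (nodeMatrix-*ᵛ val v))

    flow : Flow D +M x u₀ val
    flow .at-input k = begin
      val (input k)                             ≈⟨ *-identityˡ _ ⟨
      1# * val (input k)                        ≈⟨ *-congʳ (divisor-input k) ⟨
      divisor (entering (input k)) * val (input k)      ≈⟨ balance (input k) ⟨
      sources val (input k)                     ≈⟨ total-input _ k ⟩
      0#                                        ∎
    flow .at-inner v v≢ with classify D v
    ... | first-order i ≡.refl = sym (total-first-order _ i)
    ... | zero-order none = begin
      val v                                     ≈⟨ *-identityˡ _ ⟨
      1# * val v                                ≈⟨ *-congʳ (divisor-zero-order _ none) ⟨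
      divisor (entering v) * val v              ≈⟨ balance v ⟨
      sources val v                             ≈⟨ total-zero-order x val _ none ⟨
      total D +M (branchSignal D +M x val) (entering v) ∎

    Sx≈0 : ∀ i → (S *ᵛ x) i ≈ 0#
    Sx≈0 i = +-identityˡ-unique _ ((P *ᵛ x) (source (inj₁ i))) (begin
      (S *ᵛ x) i + (P *ᵛ x) (source (inj₁ i))             ≈⟨ state-*ᵛ x i ⟩
      p i * x i                                           ≈⟨ *-congʳ (divisor-first-order i) ⟨
      divisor (entering (target (inj₁ i))) * x i          ≈⟨ balance (target (inj₁ i)) ⟨
      sources val (target (inj₁ i))                       ≈⟨ total-first-order _ i ⟩
      val (source (inj₁ i))                               ≈⟨ respond-unique flow _ ⟩
      (P *ᵛ x) (source (inj₁ i)) + (Q *ᵛ u₀) (source (inj₁ i))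
        ≈⟨ +-congˡ (*ᵛ-zero Q u₀ (λ _ → refl) _) ⟩
      (P *ᵛ x) (source (inj₁ i)) + 0#                     ≈⟨ +-identityʳ _ ⟩
      (P *ᵛ x) (source (inj₁ i))                          ∎)

    x≈0 : ∀ i → x i ≈ 0#
    x≈0 = leftInverse⇒kernelFree {M = S} {N} NS≈I x Sx≈0

  -- The solution of `S x = B` times the k-th unit vector, that is, the transformed state when only
  -- input `k` is driven.
  state : Fin 2 → Vector Carrier n
  state k = N *ᵛ λ i → B i k

  excited : Fin 2 → Node → Carrier
  excited k = respond (state k) (identity k)

  state-equation : ∀ i k → p i * state k i ≈ excited k (source (inj₁ i))
  state-equation i k = begin
    p i * state k i                                          ≈⟨ state-*ᵛ (state k) i ⟨
    (S *ᵛ state k) i + (P *ᵛ state k) (source (inj₁ i))      ≈⟨ +-comm _ _ ⟩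
    (P *ᵛ state k) (source (inj₁ i)) + (S *ᵛ state k) i      ≈⟨ +-congˡ S-state ⟩
    excited k (source (inj₁ i))                              ∎
    where
    S-state : (S *ᵛ state k) i ≈ (Q *ᵛ identity k) (source (inj₁ i))
    S-state = begin
      (S *ᵛ state k) i                        ≈⟨ *ᵛ-assoc S N _ i ⟨
      ((S *ᴹ N) *ᵛ λ i → B i k) i             ≈⟨ *ᵛ-cong SN≈I (λ _ → refl) i ⟩
      (identity *ᵛ λ i → B i k) i             ≈⟨ identity-sumˡ (λ i → B i k) i ⟩
      B i k                                   ≈⟨ state-Q i k ⟨
      Q (source (inj₁ i)) k                   ≈⟨ *ᵛ-identity Q _ k ⟨
      (Q *ᵛ identity k) (source (inj₁ i))     ∎

  excited-input : ∀ k k′ → excited k (input k′) ≈ identity (input k′) (input k)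
  excited-input k k′ with at-input (flow-respond (state k) (identity k)) k′
  ... | eq with k′ ≟ k
  ...   | yes ≡.refl = trans eq (trans (identity-≡ {i = k} ≡.refl) (sym (identity-≡ {i = input k} ≡.refl)))
  ...   | no k′≢k    = trans eq (trans (identity-≢ (k′≢k ∘ ≡.sym)) (sym (identity-≢ (k′≢k ∘ input-injective))))

  -- Each kind of node supplies its own equation: at an input no branch enters and the value is the
  -- prescribed 0 or 1; at the target of a first-order branch it is the state equation; elsewhere it
  -- is the node equation itself.
  nodeMatrix-excited : ∀ k v → (nodeMatrix *ᵛ excited k) v ≈ identity v (input k)
  nodeMatrix-excited k v = +-cancelʳ (sources (excited k) v) _ _ (trans (nodeMatrix-*ᵛ (excited k) v) (balance v))
    where
    flow : Flow D +M (state k) (identity k) (excited k)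
    flow = flow-respond (state k) (identity k)

    inner : ∀ {v} → (∀ k → v ≢ input k) → sources (excited k) v ≈ identity v (input k) + sources (excited k) v
    inner v≢ = sym (trans (+-congʳ (identity-≢ (v≢ k))) (+-identityˡ _))

    balance : ∀ v → divisor (entering v) * excited k v ≈ identity v (input k) + sources (excited k) v
    balance v with any? (λ k′ → v ≟ input k′) | classify D v
    ... | yes (k′ , ≡.refl) | _ = begin
      divisor (entering (input k′)) * excited k (input k′)       ≈⟨ *-congʳ (divisor-input k′) ⟩
      1# * excited k (input k′)                                  ≈⟨ *-identityˡ _ ⟩
      excited k (input k′)                                       ≈⟨ excited-input k k′ ⟩
      identity (input k′) (input k)                              ≈⟨ +-identityʳ _ ⟨
      identity (input k′) (input k) + 0#                         ≈⟨ +-congˡ (total-input _ k′) ⟨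
      identity (input k′) (input k) + sources (excited k) (input k′) ∎
    ... | no v≢ | first-order i ≡.refl = begin
      divisor (entering v) * excited k v                 ≈⟨ *-cong (divisor-first-order i) (at-inner flow v λ k eq → v≢ (k , eq)) ⟩
      p i * total D +M (branchSignal D +M (state k) (excited k)) (entering v)
                                                         ≈⟨ *-congˡ (total-first-order _ i) ⟩
      p i * state k i                                    ≈⟨ state-equation i k ⟩
      excited k (source (inj₁ i))                        ≈⟨ total-first-order _ i ⟨
      sources (excited k) v                              ≈⟨ inner (λ k eq → v≢ (k , eq)) ⟩
      identity v (input k) + sources (excited k) v       ∎
    ... | no v≢ | zero-order none = begin
      divisor (entering v) * excited k v                 ≈⟨ *-cong (divisor-zero-order _ none) (at-inner flow v λ k eq → v≢ (k , eq)) ⟩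
      1# * total D +M (branchSignal D +M (state k) (excited k)) (entering v)
                                                         ≈⟨ *-identityˡ _ ⟩
      total D +M (branchSignal D +M (state k) (excited k)) (entering v)
                                                         ≈⟨ total-zero-order _ _ _ none ⟩
      sources (excited k) v                              ≈⟨ inner (λ k eq → v≢ (k , eq)) ⟩
      identity v (input k) + sources (excited k) v       ∎

  excited-output : ∀ j k → excited k (output j) ≈ ((C *ᴹ N) *ᴹ B) j k
  excited-output j k = begin
    (P *ᵛ state k) (output j) + (Q *ᵛ identity k) (output j)
      ≈⟨ +-cong (sum-cong-≋ {n} λ i → *-congʳ (output-P j i)) (trans (*ᵛ-identity Q (output j) k) (output-Q j k)) ⟩
    (C *ᵛ state k) j + 0#             ≈⟨ +-identityʳ _ ⟩
    (C *ᵛ (N *ᵛ λ i → B i k)) j       ≈⟨ *ᵛ-assoc C N _ j ⟨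
    ((C *ᴹ N) *ᵛ λ i → B i k) j       ∎

  -- This sparsity is what lets a separation of the graph act on the matrix.
  nodeMatrix-support : ∀ v w → v ≢ w → ¬ Adjacent w v → nodeMatrix v w ≈ 0#
  nodeMatrix-support v w v≢w ¬adj = begin
    divisor (entering v) * identity v w - total D +M (λ e → identity (source e) w) (entering v)
      ≈⟨ +-cong (trans (*-congˡ (identity-≢ v≢w)) (zeroʳ _)) (-‿cong (no-branches (entering v) entering-target′)) ⟩
    0# - 0#    ≈⟨ -‿inverseʳ 0# ⟩
    0#         ∎
    where
    entering-target′ : ∀ {e} → e ∈ entering v → target e ≡ v
    entering-target′ = entering-target D

    no-branches : ∀ es → (∀ {e} → e ∈ es → target e ≡ v) → total D +M (λ e → identity (source e) w) es ≈ 0#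
    no-branches []       _  = refl
    no-branches (e ∷ es) t≡ = trans
      (+-cong (identity-≢ λ s≡w → ¬adj (e , s≡w , t≡ (here ≡.refl))) (no-branches es (t≡ ∘ there)))
      (+-identityˡ 0#)

-- A separating vertex makes the transfer matrix singular

-- The columns of the m × (m + 1) matrix A are the columns of M at the near
-- vertices, the unit vectors of the far vertices and the unit vectors of both
-- inputs, one of which takes the place of the cut.
module _ (K : HeytingField c ℓ ℓ′) where
  open HeytingField K hiding (zero)
  open Matrices (ringOf K)
  open MatrixProperties (ringOf K)
  open WideMatrices K using (wide⇒¬kernelFree)
  open SemiringSum (CommutativeRing.semiring (ringOf K))
  open SemiringSolver (CommutativeRing.commutativeSemiring (ringOf K)) using (solve; _:+_; _:=_)
  open SetoidReasoning (CommutativeRing.setoid (ringOf K))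
  open Menger using (Edges; Separation)

  separation⇒¬kernelFree :
    ∀ {m} (E : Edges _≟_) (M : Matrix m m) (input output : Fin 2 → Fin m) (x : Fin 2 → Vector Carrier m) →
    KernelFree M → (∀ v w → v ≢ w → (w , v) ∉ E → M v w ≈ 0#) →
    (∀ k v → (M *ᵛ x k) v ≈ identity v (input k)) →
    Separation _≟_ E (input 0F) (input 1F) (output 0F) (output 1F) →
    ¬ KernelFree (λ j k → x k (output j))
  separation⇒¬kernelFree {m} E M input output x M-free support excite separation T-free =
    wide⇒¬kernelFree m A A-free
    where
    open Separation separation

    -- `Near` may contain the cut, so the cut is singled out: its column is given up to an input.
    data Place (w : Fin m) : Set where
      at-cut : w ≡ cut → Place w
      near   : w ≢ cut → Near w → Place w
      far    : w ≢ cut → ¬ Near w → Place w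

    place : ∀ w → Place w
    place w with w ≟ cut | near? w
    ... | yes eq | _      = at-cut eq
    ... | no neq | yes nw = near neq nw
    ... | no neq | no fw  = far neq fw

    nearWeight farWeight : ∀ {w} → Place w → Carrier
    nearWeight (near _ _) = 1#
    nearWeight _          = 0#
    farWeight (far _ _) = 1#
    farWeight _         = 0#

    A : Matrix m (suc m)
    A i zero    = identity i (input 1F)
    A i (suc w) = identity i (input 0F) * identity cut w
                  + (M i w * nearWeight (place w) + identity i w * farWeight (place w))

    start-near : ∀ k → Near⁺ (input k)
    start-near 0F = start₁
    start-near 1F = start₂

    end-far : ∀ j → ¬ Near (output j)
    end-far 0F = end₁
    end-far 1F = end₂

    A-free : KernelFree A
    A-free v Av≈0 = v≈0
      where
      a b : Carrier
      a = v (suc cut)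
      b = v zero

      y d : Vector Carrier m
      y w = nearWeight (place w) * v (suc w)
      d w = farWeight (place w) * v (suc w)

      expand : ∀ i → (A *ᵛ v) i ≈ identity i (input 1F) * b + (identity i (input 0F) * a + ((M *ᵛ y) i + d i))
      expand i = +-congˡ (begin
        sum (λ w → A i (suc w) * v (suc w))
          ≈⟨ sum-cong-≋ {m} (λ w → trans (distribʳ (v (suc w)) _ _) (+-cong (*-assoc _ _ _)
                                 (trans (distribʳ (v (suc w)) _ _) (+-cong (*-assoc _ _ _) (*-assoc _ _ _))))) ⟩
        sum (λ w → e * (identity cut w * v (suc w)) + (M i w * y w + identity i w * d w))
          ≈⟨ ∑-distrib-+ {m} (λ w → e * (identity cut w * v (suc w))) (λ w → M i w * y w + identity i w * d w) ⟩
        sum (λ w → e * (identity cut w * v (suc w))) + sum (λ w → M i w * y w + identity i w * d w)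
          ≈⟨ +-cong (sym (*-distribˡ-sum {m} e (λ w → identity cut w * v (suc w))))
                    (∑-distrib-+ {m} (λ w → M i w * y w) (λ w → identity i w * d w)) ⟩
        e * sum (λ w → identity cut w * v (suc w)) + ((M *ᵛ y) i + sum (λ w → identity i w * d w))
          ≈⟨ +-cong (*-congˡ (identity-sumˡ (v ∘ suc) cut)) (+-congˡ (identity-sumˡ d i)) ⟩
        e * a + ((M *ᵛ y) i + d i) ∎)
        where e = identity i (input 0F)

      unit-far : ∀ {i} k t → i ≢ cut → ¬ Near i → identity i (input k) * t ≈ 0#
      unit-far {i} k t i≢cut fi = trans (*-congʳ (identity-≢ {i = i} {input k} λ { ≡.refl → [ fi , i≢cut ]′ (start-near k) })) (zeroˡ t)

      -- A nonzero entry in a far row of a near column would be an edge that leaves `Near` without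
      -- entering the cut.
      My-far : ∀ {i} → i ≢ cut → ¬ Near i → (M *ᵛ y) i ≈ 0#
      My-far {i} i≢cut fi = sum-zero (λ w → M i w * y w) entry
        where
        entry : ∀ w → M i w * y w ≈ 0#
        entry w with place w
        ... | at-cut _  = trans (*-congˡ (zeroˡ _)) (zeroʳ _)
        ... | far _ _   = trans (*-congˡ (zeroˡ _)) (zeroʳ _)
        ... | near _ nw = trans (*-congʳ (support i w (λ { ≡.refl → fi nw }) λ e → [ fi , i≢cut ]′ (closed e nw))) (zeroˡ _)

      -- In a far row both input columns and all near columns vanish, so only the padding
      -- coefficient is left of `Av≈0`.
      d≈0 : ∀ i → d i ≈ 0#
      d≈0 i with place i in eq
      ... | at-cut _    = zeroˡ _
      ... | near _ _    = zeroˡ _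
      ... | far i≢cut fi = begin
        1# * v (suc i)                    ≡⟨ ≡.cong (λ q → farWeight q * v (suc i)) eq ⟨
        d i                               ≈⟨ +-identityˡ _ ⟨
        0# + d i                          ≈⟨ +-congʳ (My-far i≢cut fi) ⟨
        (M *ᵛ y) i + d i                  ≈⟨ +-identityˡ _ ⟨
        0# + ((M *ᵛ y) i + d i)           ≈⟨ +-congʳ (unit-far 0F a i≢cut fi) ⟨
        identity i (input 0F) * a + ((M *ᵛ y) i + d i)      ≈⟨ +-identityˡ _ ⟨
        0# + (identity i (input 0F) * a + ((M *ᵛ y) i + d i))   ≈⟨ +-congʳ (unit-far 1F b i≢cut fi) ⟨
        identity i (input 1F) * b + (identity i (input 0F) * a + ((M *ᵛ y) i + d i)) ≈⟨ expand i ⟨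
        (A *ᵛ v) i                        ≈⟨ Av≈0 i ⟩
        0#                                ∎

      -- Replacing each input's unit vector by its preimage under `M` writes the dependency as `M`
      -- applied to one vector.
      excitation : Vector Carrier m
      excitation w = x 1F w * b + (x 0F w * a + y w)

      M-excitation : ∀ i → (M *ᵛ excitation) i ≈ 0#
      M-excitation i = begin
        (M *ᵛ excitation) i
          ≈⟨ *ᵛ-distribˡ M (λ w → x 1F w * b) (λ w → x 0F w * a + y w) i ⟩
        (M *ᵛ (λ w → x 1F w * b)) i + (M *ᵛ (λ w → x 0F w * a + y w)) i
          ≈⟨ +-cong (scaled 1F b) (trans (*ᵛ-distribˡ M (λ w → x 0F w * a) y i) (+-congʳ (scaled 0F a))) ⟩
        identity i (input 1F) * b + (identity i (input 0F) * a + (M *ᵛ y) i)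
          ≈⟨ +-congˡ (+-congˡ (trans (+-congˡ (d≈0 i)) (+-identityʳ _))) ⟨
        identity i (input 1F) * b + (identity i (input 0F) * a + ((M *ᵛ y) i + d i))
          ≈⟨ expand i ⟨
        (A *ᵛ v) i ≈⟨ Av≈0 i ⟩
        0# ∎
        where
        scaled : ∀ k t → (M *ᵛ (λ w → x k w * t)) i ≈ identity i (input k) * t
        scaled k t = trans (*ᵛ-scale M t (x k) i) (*-congʳ (excite k i))

      excitation≈0 : ∀ w → excitation w ≈ 0#
      excitation≈0 = M-free excitation M-excitation

      ab : Vector Carrier 2
      ab 0F = a
      ab 1F = b

      y-far : ∀ {w} → ¬ Near w → y w ≈ 0#
      y-far {w} fw with place w
      ... | at-cut _  = zeroˡ _
      ... | far _ _   = zeroˡ _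
      ... | near _ nw = contradiction nw fw

      -- At an output the near part `y` is 0, so the vanishing of `excitation` there is the kernel
      -- equation for `ab` that `T-free` resolves.
      ab≈0 : ∀ k → ab k ≈ 0#
      ab≈0 = T-free ab λ j → begin
        x 0F (output j) * a + (x 1F (output j) * b + 0#)
          ≈⟨ solve 3 (λ p q r → p :+ (q :+ r) := q :+ (p :+ r)) refl (x 0F (output j) * a) (x 1F (output j) * b) 0# ⟩
        x 1F (output j) * b + (x 0F (output j) * a + 0#)
          ≈⟨ +-congˡ (+-congˡ (y-far (end-far j))) ⟨
        excitation (output j)      ≈⟨ excitation≈0 (output j) ⟩
        0#                         ∎

      y≈0 : ∀ w → y w ≈ 0#
      y≈0 w = begin
        y w                                    ≈⟨ +-identityˡ _ ⟨
        0# + y w                               ≈⟨ +-congʳ (trans (*-congˡ (ab≈0 0F)) (zeroʳ _)) ⟨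
        x 0F w * a + y w                       ≈⟨ +-identityˡ _ ⟨
        0# + (x 0F w * a + y w)                ≈⟨ +-congʳ (trans (*-congˡ (ab≈0 1F)) (zeroʳ _)) ⟨
        excitation w                           ≈⟨ excitation≈0 w ⟩
        0#                                     ∎

      v≈0 : ∀ j → v j ≈ 0#
      v≈0 zero    = ab≈0 1F
      v≈0 (suc w) with place w | y≈0 w | d≈0 w
      ... | at-cut ≡.refl | _   | _   = ab≈0 0F
      ... | near _ _      | y≈0 | _   = trans (sym (*-identityˡ _)) y≈0
      ... | far _ _       | _   | d≈0 = trans (sym (*-identityˡ _)) d≈0

-- From disjoint walks to a general 2-path

module _ {n} (D : SignalFlowGraph n) where
  open SignalFlowGraph D
  open DecMembership (_≟_ {#nodes}) using (_∈?_)
  open Menger (_≟_ {#nodes})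

  edges : Edges
  edges = map (λ e → source e , target e) branches

  edge⇒adjacent : ∀ {v w} → (v , w) ∈ edges → Adjacent v w
  edge⇒adjacent e∈ with ∈-map⁻ (λ e → source e , target e) e∈
  ... | e , _ , ≡.refl = e , ≡.refl , ≡.refl

  adjacent⇒edge : ∀ {v w} → Adjacent v w → (v , w) ∈ edges
  adjacent⇒edge (e , ≡.refl , ≡.refl) = ∈-map⁺ (λ e → source e , target e) (∈-branches D e)

  suffix : ∀ {x y z} (p : Walk y z) → Unique (nodes p) → x ∈ nodes p →
           Σ (Path x z) λ q → nodes (proj₁ q) ⊆ nodes p
  suffix ε       uniq       (here ≡.refl) = (ε , uniq) , id
  suffix (e ◅ p) uniq       (here ≡.refl) = (e ◅ p , uniq) , id
  suffix (e ◅ p) (_ ∷ uniq) (there x∈)    with suffix p uniq x∈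
  ... | q , q⊆p = q , there ∘ q⊆p

  -- If the new first vertex already lies on the loop-free remainder, the remainder is restarted
  -- there. No vertex is ever added, which preserves disjointness.
  eraseLoops : ∀ {x y} (p : WalkIn edges x y) → Σ (Path x y) λ q → nodes (proj₁ q) ⊆ vertices p
  eraseLoops ε = (ε , [] ∷ []) , id
  eraseLoops {x} (e ◅ p) with eraseLoops p
  ... | (q , uniq) , q⊆p with x ∈? nodes q
  ...   | yes x∈q = let r , r⊆q = suffix q uniq x∈q in r , there ∘ q⊆p ∘ r⊆q
  ...   | no x∉q  = (edge⇒adjacent e ◅ q , ¬Any⇒All¬ (nodes q) x∉q ∷ uniq) ,
    λ { (here eq) → here eq ; (there ∈q) → there (q⊆p ∈q) }

  linkage⇒general2Path : Linkage edges (input 0F) (input 1F) (output 0F) (output 1F) → General2Path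
  linkage⇒general2Path = [ pair Permutation.id , pair (Permutation.transpose 0F 1F) ]′
    where
    pair : ∀ π → DisjointWalks edges (input (π Permutation.⟨$⟩ʳ 0F)) (output 0F)
                                     (input (π Permutation.⟨$⟩ʳ 1F)) (output 1F) → General2Path
    pair π (p , q , p∥q) with eraseLoops p | eraseLoops q
    ... | p′ , p′⊆p | q′ , q′⊆q = π , p′ , q′ , λ (∈p′ , ∈q′) → p∥q (p′⊆p ∈p′ , q′⊆q ∈q′)

-- Clearing denominators and comparing coefficients reduces uniqueness over
-- K(s) to uniqueness over K.
module _ {n} (D : SignalFlowGraph n) where
  open SignalFlowGraph D

  FlowUnique : CommutativeMonoid c ℓ → Set (c ⊔ ℓ)
  FlowUnique M = ∀ w → Flow D M (λ _ → ε′) (λ _ → ε′) w → ∀ v → w v ≈ ε′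
    where open CommutativeMonoid M renaming (ε to ε′)

  module _ (L : HeytingField c ℓ ℓ′) (M : CommutativeMonoid c₁ ℓ₁) where
    open HeytingField L hiding (zero)
    open HeytingProperties heytingCommutativeRing using (x#0y#0→xy#0)
    private
      module M = CommutativeMonoid M
      +L = CommutativeRing.+-commutativeMonoid (ringOf L)

    -- After scaling by `d` the flow comes from `M` and is therefore 0. A value of `w` apart from 0
    -- would stay so after multiplication by `d`, so tightness gives the claim.
    flowUnique-extend :
      (f : M.Carrier → Carrier) →
      MonoidMorphisms.IsMonoidHomomorphism M.rawMonoid (CommutativeMonoid.rawMonoid +L) f →
      (∀ {a b} → f a ≈ f b → a M.≈ b) →
      (∀ w → Σ Carrier λ d → Σ (Node → M.Carrier) λ r → d # 0# × (∀ v → d * w v ≈ f (r v))) →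
      FlowUnique M → FlowUnique +L
    flowUnique-extend f hom inj clear unique w F v with clear w
    ... | d , r , d#0 , dw≈r = proj₁ (tight (w v) 0#) λ wv#0 → #-irrefl dwv≈0 (x#0y#0→xy#0 d#0 wv#0)
      where
      scaled : Flow D +L (f ∘ λ _ → M.ε) (f ∘ λ _ → M.ε) (f ∘ r)
      scaled = flow-cong D +L (λ _ → d0≈f0) (λ _ → d0≈f0) dw≈r
        (flow-map D +L +L record
          { isMagmaHomomorphism = record
            { isRelHomomorphism = record { cong = *-congˡ }
            ; homo = distribˡ d }
          ; ε-homo = zeroʳ d } F)
        where
        open MonoidMorphisms.IsMonoidHomomorphism hom
        d0≈f0 : d * 0# ≈ f M.ε
        d0≈f0 = trans (zeroʳ d) (sym ε-homo)

      dwv≈0 : d * w v ≈ 0#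
      dwv≈0 = trans (dw≈r v) (trans (⟦⟧-cong (unique r (flow-reflect D M +L hom inj scaled) v)) ε-homo)
        where open MonoidMorphisms.IsMonoidHomomorphism hom

  -- Taking the k-th coefficient is additive, so it turns a flow of polynomials into a flow over
  -- `R`.
  flowUnique-polynomial : (R : CommutativeRing c ℓ) → FlowUnique (CommutativeRing.+-commutativeMonoid R) →
    FlowUnique (CommutativeRing.+-commutativeMonoid (Polynomials.polynomialRing R))
  flowUnique-polynomial R unique w F v = coeffwise λ k → unique (λ v → coeff (w v) k) (flow-map D _ +R record
    { isMagmaHomomorphism = record
      { isRelHomomorphism = record { cong = λ eq → at eq k }
      ; homo = λ p q → coeff-+ p q k }
    ; ε-homo = CommutativeRing.refl R } F) v
    where
    open Polynomials R
    +R = CommutativeRing.+-commutativeMonoid R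

-- Uniqueness of node values over K(s)

module _ (K : HeytingField c ℓ ℓ′) where
  private
    L = RationalFunctions K
    module L = HeytingField L
    +K = CommutativeRing.+-commutativeMonoid (ringOf K)
    +L = CommutativeRing.+-commutativeMonoid (ringOf L)
    open Polynomials (ringOf K)
    +P = CommutativeRing.+-commutativeMonoid polynomialRing
    module F = Fractions polynomialRing (polynomial-isApartDomain (field-isApartDomain K))

  constant-homo : MonoidMorphisms.IsMonoidHomomorphism (CommutativeMonoid.rawMonoid +K)
                    (CommutativeMonoid.rawMonoid +L) (constant K)
  constant-homo = record
    { isMagmaHomomorphism = record
      { isRelHomomorphism = record { cong = λ {a} {b} eq → F.embed-cong {a ∷ []} {b ∷ []} (∷-cong eq ≈ᴾ-refl) }
      ; homo = λ a b → F.embed-+ (a ∷ []) (b ∷ []) }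
    ; ε-homo = F.embed-cong {HeytingField.0# K ∷ []} {[]} 0∷[] }

  fromPolynomial-homo : MonoidMorphisms.IsMonoidHomomorphism (CommutativeMonoid.rawMonoid +P)
                          (CommutativeMonoid.rawMonoid +L) (fromPolynomial K)
  fromPolynomial-homo = record
    { isMagmaHomomorphism = record
      { isRelHomomorphism = record { cong = λ {p} {q} → F.embed-cong {p} {q} }
      ; homo = F.embed-+ }
    ; ε-homo = L.refl {L.0#} }

  flowUnique-RationalFunctions : ∀ {n} (D : SignalFlowGraph n) → FlowUnique D +K → FlowUnique D +L
  flowUnique-RationalFunctions D unique =
    flowUnique-extend D L +P (fromPolynomial K) fromPolynomial-homo (λ {p} {q} → F.embed-injective {p} {q}) clear
      (flowUnique-polynomial D (ringOf K) unique)
    where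
    open SignalFlowGraph D using (Node)

    clear : ∀ w → Σ L.Carrier λ d → Σ (Node → Polynomial) λ r →
            d L.# L.0# × (∀ v → d L.* w v L.≈ fromPolynomial K (r v))
    clear w with F.commonDenominator w
    ... | d , r , d-nz , dw≈r = fromPolynomial K d , r , F.embed-# {d} d-nz , dw≈r

module _ (L : HeytingField c ℓ ℓ′) {n} (D : SignalFlowGraph n) where
  open HeytingField L using (trans; sym; refl)
  open SignalFlowGraph D
  open Menger (_≟_ {#nodes}) using (menger)
  open Matrices (ringOf L)
  open MatrixProperties (ringOf L)

  -- Invertibility of `T` enters only through its left inverse, which gives the trivial kernel that
  -- a separation rules out.
  response⇒general2Path : (response : Response (ringOf L) D) → let open Response response in
    ∀ T → T ≈ᴹ (C *ᴹ N) *ᴹ B → IsInvertible T → General2Path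
  response⇒general2Path response T T≈CNB (T⁻¹ , _ , T⁻¹T≈I)
    with menger (edges D) (input 0F) (input 1F) (output 0F) (output 1F)
  ... | inj₁ linkage    = linkage⇒general2Path D linkage
  ... | inj₂ separation = ⊥-elim (separation⇒¬kernelFree L (edges D) nodeMatrix input output excited
    nodeMatrix-kernelFree
    (λ v w v≢w ∉E → nodeMatrix-support v w v≢w (∉E ∘ adjacent⇒edge D))
    nodeMatrix-excited separation
    λ v Ev≈0 → leftInverse⇒kernelFree {M = T} {T⁻¹} T⁻¹T≈I v λ j → trans
      (*ᵛ-cong {v = v} {w = v} (λ j k → trans (T≈CNB j k) (sym (excited-output j k))) (λ _ → refl) j)
      (Ev≈0 j))
    where open ResponseProperties response

-- The response of the linear system over K(s)

module _ (K : HeytingField c ℓ ℓ′) {n} (D : SignalFlowGraph n) where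
  open SignalFlowGraph D
  private
    +K = CommutativeRing.+-commutativeMonoid (ringOf K)

  nodeEquations⇒flow : ∀ {x u val} → NodeEquations K D x u val → Flow D +K x u val
  nodeEquations⇒flow E .Flow.at-input = NodeEquations.at-input E
  nodeEquations⇒flow {x} {u} {val} E .Flow.at-inner v v≢ = HeytingField.trans K (NodeEquations.at-inner E v v≢)
    (total-cong D +K (λ { (inj₁ i) → HeytingField.refl K ; (inj₂ j) → HeytingField.refl K }) (entering v))

  flow⇒nodeEquations : ∀ {x u val} → Flow D +K x u val → NodeEquations K D x u val
  flow⇒nodeEquations F .NodeEquations.at-input = Flow.at-input F
  flow⇒nodeEquations F .NodeEquations.at-inner v v≢ = HeytingField.trans K (Flow.at-inner F v v≢)
    (total-cong D +K (λ { (inj₁ i) → HeytingField.refl K ; (inj₂ j) → HeytingField.refl K }) (entering v))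

  module _ {z : Vector (HeytingField.Carrier K) n} {system : LinearSystem K n}
           (isSystem : IsLinearSystemOf K D z system) where
    open IsLinearSystemOf isSystem
    open LinearSystem system
    private module K where
      open HeytingField K public
      open Matrices (ringOf K) public
      open MatrixProperties (ringOf K) public

    flowUnique : FlowUnique D +K
    flowUnique w F v = K.trans (node-unique _ _ w (flow⇒nodeEquations F) v)
      (K.sym (node-unique _ _ (λ _ → K.0#) (flow⇒nodeEquations (flow-0 D +K)) v))

    -- φ : K → L and s stand for the constants and the indeterminate of K(s).
    module _ (L : HeytingField c₁ ℓ₁ ℓ₂) (φ : K.Carrier → HeytingField.Carrier L)
             (hom : MonoidMorphisms.IsMonoidHomomorphism (CommutativeMonoid.rawMonoid +K)
                      (CommutativeMonoid.rawMonoid (CommutativeRing.+-commutativeMonoid (ringOf L))) φ)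
             (φ-1 : HeytingField._≈_ L (φ K.1#) (HeytingField.1# L))
             (s : HeytingField.Carrier L) where
      open HeytingField L hiding (zero)
      open Matrices (ringOf L)
      open MatrixProperties (ringOf L)
      open RingProperties (CommutativeRing.ring (ringOf L)) using (-‿distribˡ-*; -‿+-comm)
      open SetoidReasoning (CommutativeRing.setoid (ringOf L))
      open MonoidMorphisms.IsMonoidHomomorphism hom renaming (⟦⟧-cong to φ-cong; homo to φ-+; ε-homo to φ-0)
      private +L = CommutativeRing.+-commutativeMonoid (ringOf L)

      φ-identity : ∀ {m} (i j : Fin m) → φ (K.identity i j) ≈ identity i j
      φ-identity i j with i ≟ j
      ... | yes _ = φ-1
      ... | no _  = φ-0

      -- `φ` is only known to be additive with `φ-1`, but one factor is 0 or 1. The indices are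
      -- transposed because the j-th unit state has entries `identity j i`.
      φ-*-identity : ∀ {m} a (i j : Fin m) → φ (a K.* K.identity j i) ≈ φ a * identity i j
      φ-*-identity a i j with i ≟ j
      ... | yes eq = trans (φ-cong (K.trans (K.*-congˡ (K.identity-≡ (≡.sym eq))) (K.*-identityʳ a))) (sym (*-identityʳ _))
      ... | no neq = trans (φ-cong (K.trans (K.*-congˡ (K.identity-≢ (neq ∘ ≡.sym))) (K.zeroʳ a))) (trans φ-0 (sym (zeroʳ _)))

      -- By superposition it is enough to evaluate the system at unit states and unit inputs. There
      -- the state equation yields the columns of `A` and `B` and the output equation those of `C`;
      -- at zero state the outputs vanish, so nothing passes directly from input to output.
      systemResponse :
        (S N : Matrix n n) → (∀ i j → S i j ≈ s * identity i j - φ (A i j)) → IsInverse S N →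
        FlowUnique D +L → Response (ringOf L) D
      systemResponse S N S≈ (SN≈I , NS≈I) unique = record
        { p = λ i → s - φ (z i)
        ; S = S
        ; N = N
        ; B = λ i k → φ (B i k)
        ; C = λ k i → φ (C k i)
        ; P = λ v i → φ (nodeValues (K.identity i) (λ _ → K.0#) v)
        ; Q = λ v k → φ (nodeValues (λ _ → K.0#) (K.identity k) v)
        ; NS≈I = NS≈I
        ; SN≈I = SN≈I
        ; flow-P = λ i → flow-cong D +L (φ-identity i) (λ _ → φ-0) (λ _ → refl)
                     (flow-map D +K +L hom (nodeEquations⇒flow (node-equations _ _)))
        ; flow-Q = λ k → flow-cong D +L (λ _ → φ-0) (φ-identity k) (λ _ → refl)
                     (flow-map D +K +L hom (nodeEquations⇒flow (node-equations _ _)))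
        ; unique = unique
        ; state-P = state-P
        ; state-Q = λ i k → φ-cong (K.trans (K.sym (K.trans (K.+-congʳ (K.zeroʳ (z i))) (K.+-identityˡ _)))
            (K.trans (state-equation (λ _ → K.0#) (K.identity k) i)
              (K.trans (K.+-cong (K.*ᵛ-zero A _ (λ _ → K.refl) i) (K.*ᵛ-identity B i k)) (K.+-identityˡ _))))
        ; output-P = λ k i → φ-cong (K.trans (output-equation (K.identity i) _ k) (K.*ᵛ-identity C k i))
        ; output-Q = λ k j → trans (φ-cong (K.trans (output-equation _ (K.identity j) k)
                                                    (K.*ᵛ-zero C _ (λ _ → K.refl) k))) φ-0
        }
        where
        state-P : ∀ i j → S i j + φ (nodeValues (K.identity j) (λ _ → K.0#) (source (inj₁ i)))
                          ≈ (s - φ (z i)) * identity i j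
        state-P i j = begin
          S i j + ν                          ≈⟨ +-congʳ (S≈ i j) ⟩
          (s * δ - φ (A i j)) + ν            ≈⟨ +-congʳ (+-congˡ (-‿cong decompose)) ⟨
          (s * δ - (φ (z i) * δ + ν)) + ν    ≈⟨ +-assoc _ _ _ ⟩
          s * δ + (- (φ (z i) * δ + ν) + ν)  ≈⟨ +-congˡ (+-congʳ (-‿+-comm (φ (z i) * δ) ν)) ⟨
          s * δ + ((- (φ (z i) * δ) - ν) + ν)  ≈⟨ +-congˡ (trans (+-assoc _ _ _) (trans (+-congˡ (-‿inverseˡ ν)) (+-identityʳ _))) ⟩
          s * δ + - (φ (z i) * δ)            ≈⟨ +-congˡ (-‿distribˡ-* (φ (z i)) δ) ⟩
          s * δ + - φ (z i) * δ              ≈⟨ distribʳ δ s (- φ (z i)) ⟨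
          (s - φ (z i)) * δ                  ∎
          where
          δ = identity i j
          ν = φ (nodeValues (K.identity j) (λ _ → K.0#) (source (inj₁ i)))

          decompose : φ (z i) * δ + ν ≈ φ (A i j)
          decompose = trans (+-congʳ (sym (φ-*-identity (z i) i j))) (trans (sym (φ-+ _ _))
            (φ-cong (K.trans (state-equation (K.identity j) (λ _ → K.0#) i)
              (K.trans (K.+-cong (K.*ᵛ-identity A i j) (K.*ᵛ-zero B _ (λ _ → K.refl) i)) (K.+-identityʳ _)))))

      general2Path :
        (S N : Matrix n n) → (∀ i j → S i j ≈ s * identity i j - φ (A i j)) → IsInverse S N →
        FlowUnique D +L →
        ∀ T → T ≈ᴹ ((λ k i → φ (C k i)) *ᴹ N) *ᴹ (λ i k → φ (B i k)) → IsInvertible T → General2Path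
      general2Path S N S≈ inverse unique = response⇒general2Path L D (systemResponse S N S≈ inverse unique)

module _ (K : HeytingField c ℓ ℓ′) where
  private
    L = RationalFunctions K
    module L = HeytingField L

  constant-1 : constant K (HeytingField.1# K) L.≈ L.1#
  constant-1 = L.refl {L.1#}

  sI-entry : ∀ {n} (A : Matrices.Matrix (ringOf K) n n) i j →
             (sI-_ K A) i j L.≈ indeterminate K L.* Matrices.identity (ringOf L) i j L.- constant K (A i j)
  sI-entry A i j = L.refl {sI-_ K A i j}

  invertibleTransfer⇒general2Path :
    ∀ {n} (D : SignalFlowGraph n) {z} {system : LinearSystem K n} → IsLinearSystemOf K D z system →
    let open Matrices (ringOf L) in
    (T : Matrix 2 2) → IsTransferMatrix K system T → IsInvertible T → SignalFlowGraph.General2Path D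
  invertibleTransfer⇒general2Path D {system = system} isSystem T (N , inverse , T≈CNB) =
    general2Path K D isSystem L (constant K) (constant-homo K) constant-1 (indeterminate K)
      (sI-_ K A) N (sI-entry A) inverse
      (flowUnique-RationalFunctions K D (flowUnique K D isSystem))
      T T≈CNB
    where open LinearSystem system

theorem3p1 : ∀ {ℓ} (F : HeytingField ℓ ℓ ℓ) {n k : ℕ} (D : SignalFlowGraph n) (poles : Poles F k n) →
    let K = RationalFunctionsIn k F
        open Matrices (ringOf (RationalFunctions K))
    in
    (system : LinearSystem K n) → IsLinearSystemOf K D (Poles.poleValue poles) system →
    (T : Matrix 2 2) → IsTransferMatrix K system T →
    IsInvertible T → SignalFlowGraph.General2Path D
theorem3p1 F {k = k} D poles system = invertibleTransfer⇒general2Path (RationalFunctionsIn k F) D
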